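{- Let $b$ be a connected locally finite weighted graph over an at most countable set $V$ with values in an ordered field $\mathbb K$, let $\pi=\pi_V^b$ be the associated real transition matrix (with $U=V$), and let $a\in V$. (a) If $a$ is a recurrent state (with respect to $\pi$), then $G(a)=\infty$. (b) If $G(a)<\infty$, then $a$ is a transient state (with respect to $\pi$).
   Context: Let $(\mathbb K,\succ)$ be an ordered field and $\mathbb K^+=\{k\succ 0\}$. Weighted graph: a symmetric map $b:V\times V\to\mathbb K^+\cup\{0\}$ with $b(x,x)=0$; $x\sim y$ means $b(x,y)\succ 0$. Connected: any two vertices $x,y$ are joined by a path $x=x_0\sim\dots\sim x_n=y$. Locally finite: every vertex has finitely many neighbors. A subset is connected if the restriction of $b$ to it is connected. Put $b(x)=\sum_{y\in V}b(x,y)$ and $p(x,y)=b(x,y)/b(x)$ ($b(x)\succ0$ is automatic when $V$ has at least two elements). Real part: for $k\in\mathbb K$ with $|k|\prec c$ for some positive rational $c$, $\rho(k)$ is the unique real number such that $|k-\rho(k)|$ is smaller than every positive rational in an ordered field containing $\mathbb K$ and $\mathbb R$; equivalently $\rho(k)=\sup_{\mathbb R}\{q\in\mathbb Q: q\preceq k\}$. $\pi_V^b(x,y)=\rho(p(x,y))$ for $x,y\in V$; this is a real transition matrix. A state $x$ is recurrent if the Markov chain $(X_n)$ with transition matrix $\pi_V^b$ started at $x$ satisfies $\mathbb P[X_n=x\text{ for infinitely many }n]=1$, and transient otherwise. Capacity: $\Delta f(x)=\frac1{b(x)}\sum_{y}b(x,y)(f(x)-f(y))$ for $f:V\to\mathbb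 K$. For finite connected $K\subseteq V$ and $a\in K$ there is a unique $v:V\to\mathbb K$ with $\Delta v=0$ on $K\setminus\{a\}$, $v(a)=1$, $v=0$ on $V\setminus K$; it satisfies $0\preceq v\preceq 1$. Put $\operatorname{cap}_K(a)=b(a)\Delta v(a)$. Then $0\preceq\operatorname{cap}_K(a)/b(a)\preceq1$, and $G_K(a)=1/\rho\big(\operatorname{cap}_K(a)/b(a)\big)\in[1,\infty]$ with $1/0=\infty$. For an exhaustion $(K_n)$ of $V$ (increasing sequence of finite connected sets with union $V$) with $a\in K_0$, $G(a)=\limsup_{n\to\infty}G_{K_n}(a)\in[1,\infty]$ (the sequence is monotone increasing, so this is a limit). -}

module Defs where

open import Level using (0ℓ) renaming (suc to ℓsuc)
open import Algebra.Bundles using (CommutativeRing)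
import Algebra.Definitions.RawMonoid as RawMonoidDefs
import Algebra.Properties.AbelianGroup as AbelianGroupProperties
import Algebra.Properties.Ring as RingProperties
open import Data.Integer as ℤ using (ℤ)
open import Data.List using (List; []; _∷_; foldr; filter)
open import Data.List.Membership.Propositional using () renaming (_∈_ to _∈ˡ_; _∉_ to _∉ˡ_)
open import Data.List.Membership.Propositional.Properties using (∈-filter⁺; ∈-filter⁻)
import Data.List.Membership.DecPropositional as DecMembership
open import Data.List.Relation.Binary.Subset.Propositional using () renaming (_⊆_ to _⊆ˡ_)
open import Data.List.Relation.Unary.Any using (here; there)
open import Data.List.Relation.Unary.Unique.Propositional using (Unique)
open import Data.Nat as ℕ using (ℕ; zero; suc)
import Data.Nat.Properties as ℕ
open import Data.Product using (Σ; ∃; _×_; _,_; proj₁; proj₂; Σ-syntax; ∃-syntax)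
open import Data.Rational as ℚ using (ℚ; 0ℚ; 1ℚ; ↥_; ↧ₙ_)
import Data.Rational.Properties as ℚ
open import Data.Sum using (_⊎_; inj₁; inj₂)
open import Function using (_↣_; _⇔_; Equivalence)
open import Relation.Binary.Construct.Closure.ReflexiveTransitive using (Star; ε; _◅_)
open import Relation.Binary.Core using (Rel)
open import Relation.Binary.Definitions using (DecidableEquality; tri<; tri≈; tri>)
open import Relation.Binary.PropositionalEquality as ≡ using (_≡_; _≢_)
import Relation.Binary.Reasoning.Setoid as SetoidReasoning
open import Relation.Binary.Structures using (IsStrictTotalOrder)
open import Relation.Nullary using (¬_; yes; no; contradiction)
open import Relation.Nullary.Decidable using (¬?; via-injection)
open import Relation.Unary using (Pred; _∈_; _∉_; _⊆_; _≐_; ∁; ⋃; ⋂; _⊥_; U)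
import Algebra.Solver.Ring.NaturalCoefficients.Default as NatSolver

record OrderedField : Set₁ where
  infix 4 _≺_ _≼_
  field
    commutativeRing : CommutativeRing 0ℓ 0ℓ
  open CommutativeRing commutativeRing public
  field
    _≺_                : Rel Carrier 0ℓ
    isStrictTotalOrder : IsStrictTotalOrder _≈_ _≺_
    +-monoʳ-≺          : ∀ x {y z} → y ≺ z → x + y ≺ x + z
    *-pos              : ∀ {x y} → 0# ≺ x → 0# ≺ y → 0# ≺ x * y
    1≉0                : ¬ (1# ≈ 0#)
    inverse            : ∀ x → ¬ (x ≈ 0#) → ∃[ y ] x * y ≈ 1#

  open IsStrictTotalOrder isStrictTotalOrder public
    using (compare; _≟_)
    renaming (trans to ≺-trans; irrefl to ≺-irrefl; asym to ≺-asym;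
              <-respˡ-≈ to ≺-respˡ-≈; <-respʳ-≈ to ≺-respʳ-≈)

  _≼_ : Rel Carrier 0ℓ
  x ≼ y = x ≺ y ⊎ x ≈ y

  -- Total by the convention 0⁻¹ = 0; trichotomy decides equality.
  _⁻¹ : Carrier → Carrier
  x ⁻¹ with x ≟ 0#
  ... | yes _   = 0#
  ... | no  x≉0 = proj₁ (inverse x x≉0)

  open RawMonoidDefs +-rawMonoid using () renaming (_×_ to _·_)

  fromℤ : ℤ → Carrier
  fromℤ (ℤ.+ n)    = n · 1#
  fromℤ ℤ.-[1+ n ] = - (suc n · 1#)

  fromℚ : ℚ → Carrier
  fromℚ q = fromℤ (↥ q) * (↧ₙ q · 1#) ⁻¹

  ∑ : {I : Set} → List I → (I → Carrier) → Carrier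
  ∑ xs f = foldr (λ x s → f x + s) 0# xs

-- Extended real numbers, as (lower) Dedekind cuts: `below x` is the set
-- of all rationals strictly smaller than x.  The empty cut is -∞ and the
-- full cut is +∞.

infix 4 _≤ʳ_ _<ʳ_ _≈ʳ_
infixl 6 _+ʳ_
infixl 7 _*ʳ_

record ℝ±∞ : Set₁ where
  field
    below   : Pred ℚ 0ℓ
    lower   : ∀ {p q} → p ℚ.≤ q → q ∈ below → p ∈ below
    rounded : ∀ {p} → p ∈ below → ∃[ q ] p ℚ.< q × q ∈ below
open ℝ±∞ public

_≤ʳ_ _<ʳ_ _≈ʳ_ : ℝ±∞ → ℝ±∞ → Set
x ≤ʳ y = below x ⊆ below y
x <ʳ y = ∃[ q ] q ∉ below x × q ∈ below y
x ≈ʳ y = below x ≐ below y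

sup : Pred ℚ 0ℓ → ℝ±∞
sup S = record
  { below   = λ q → ∃[ t ] t ∈ S × q ℚ.< t
  ; lower   = λ { p≤q (t , t∈S , q<t) → t , t∈S , ℚ.≤-<-trans p≤q q<t }
  ; rounded = λ { (t , t∈S , q<t) →
      let r , q<r , r<t = ℚ.<-dense q<t in r , q<r , t , t∈S , r<t }
  }

0ʳ 1ʳ ∞ : ℝ±∞
0ʳ = sup (_≡ 0ℚ)
1ʳ = sup (_≡ 1ℚ)
∞  = sup U

_+ʳ_ : ℝ±∞ → ℝ±∞ → ℝ±∞
x +ʳ y = sup λ q → ∃[ s ] ∃[ t ] s ∈ below x × t ∈ below y × q ≡ s ℚ.+ t

-- Multiplication and inversion are the usual ones on [0,∞], with
-- 0 · ∞ = 0, 1 / 0 = ∞ and 1 / ∞ = 0; they are only used there.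
_*ʳ_ : ℝ±∞ → ℝ±∞ → ℝ±∞
x *ʳ y = sup λ q → q ≡ 0ℚ ⊎
  (∃[ s ] ∃[ t ] (0ℚ ℚ.≤ s × s ∈ below x) × (0ℚ ℚ.≤ t × t ∈ below y) × q ≡ s ℚ.* t)

1/ʳ_ : ℝ±∞ → ℝ±∞
1/ʳ x = sup λ t → 0ℚ ℚ.≤ t × (∀ {s} → s ∈ below x → t ℚ.* s ℚ.≤ 1ℚ)

partialSum : (ℕ → ℝ±∞) → ℕ → ℝ±∞
partialSum x zero    = 0ʳ
partialSum x (suc n) = partialSum x n +ʳ x n

-- The sum of a series with terms in [0,∞].
series : (ℕ → ℝ±∞) → ℝ±∞
series x = sup λ q → ∃[ n ] q ∈ below (partialSum x n)

limsup : (ℕ → ℝ±∞) → ℝ±∞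
limsup x = sup λ q → ∀ N → ∃[ n ] N ℕ.≤ n × q ∈ below (x n)

-- Closure under intersections, invariance under ≐ and monotonicity are
-- redundant classically but not constructively.  The values of `P` on
-- sets that are not events are irrelevant.
record ProbabilitySpace : Set₂ where
  field
    Ω        : Set
    Event    : Pred (Pred Ω 0ℓ) (ℓsuc 0ℓ)
    U-event  : Event U
    ∁-event  : ∀ {A} → Event A → Event (∁ A)
    ⋃-event  : ∀ {A : ℕ → Pred Ω 0ℓ} → (∀ n → Event (A n)) → Event (⋃ ℕ A)
    ⋂-event  : ∀ {A : ℕ → Pred Ω 0ℓ} → (∀ n → Event (A n)) → Event (⋂ ℕ A)
    ≐-event  : ∀ {A B} → A ≐ B → Event A → Event B

    P        : Pred Ω 0ℓ → ℝ±∞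
    P-nonNeg : ∀ {A} → Event A → 0ʳ ≤ʳ P A
    P-mono   : ∀ {A B} → Event A → Event B → A ⊆ B → P A ≤ʳ P B
    P-U      : P U ≈ʳ 1ʳ
    P-⋃      : ∀ {A : ℕ → Pred Ω 0ℓ} → (∀ n → Event (A n)) →
               (∀ {m n} → m ≢ n → A m ⊥ A n) →
               P (⋃ ℕ A) ≈ʳ series (λ n → P (A n))

record MarkovChain {V : Set} (π : V → V → ℝ±∞) (x : V) : Set₂ where
  field
    space : ProbabilitySpace
  open ProbabilitySpace space public
  field
    X       : ℕ → Ω → V
    X-event : ∀ n y → Event (λ ω → X n ω ≡ y)

  History : ℕ → (ℕ → V) → Pred Ω 0ℓ
  History n y = λ ω → ∀ i → i ℕ.≤ n → X i ω ≡ y i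

  field
    start  : P (λ ω → X 0 ω ≡ x) ≈ʳ 1ʳ
    -- P[X₀ = y₀, …, Xₙ₊₁ = yₙ₊₁] = P[X₀ = y₀, …, Xₙ = yₙ] · π(yₙ, yₙ₊₁)
    markov : ∀ n y → P (History (suc n) y) ≈ʳ P (History n y) *ʳ π (y n) (y (suc n))

  InfinitelyOften : V → Pred Ω 0ℓ
  InfinitelyOften y = λ ω → ∀ m → ∃[ n ] m ℕ.≤ n × X n ω ≡ y

-- The chain started at x is unique in law, so it does not matter which
-- realisation of it is considered.
Recurrent Transient : {V : Set} → (V → V → ℝ±∞) → V → Set₂
Recurrent π x = Σ[ chain ∈ MarkovChain π x ]
  (let open MarkovChain chain in P (InfinitelyOften x) ≈ʳ 1ʳ)
Transient π x = ¬ Recurrent π x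

record WeightedGraph (𝕂 : OrderedField) (V : Set) : Set where
  open OrderedField 𝕂
  field
    b        : V → V → Carrier
    b-sym    : ∀ x y → b x y ≈ b y x
    b-diag   : ∀ x → b x x ≈ 0#
    b-nonNeg : ∀ x y → 0# ≼ b x y

  infix 4 _∼_
  _∼_ : Rel V 0ℓ
  x ∼ y = 0# ≺ b x y

  Connected : Set
  Connected = ∀ x y → Star _∼_ x y

  -- Finite sets of vertices are given by lists (of which only the
  -- membership relation matters).
  ConnectedSet : List V → Set
  ConnectedSet K = ∀ {x y} → x ∈ˡ K → y ∈ˡ K →
    Star (λ u w → u ∈ˡ K × w ∈ˡ K × u ∼ w) x y

  LocallyFinite : Set
  LocallyFinite = ∀ x → ∃[ ys ] Unique ys × (∀ y → y ∈ˡ ys ⇔ x ∼ y)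

  record Exhaustion : Set where
    field
      K           : ℕ → List V
      K-connected : ∀ n → ConnectedSet (K n)
      K-mono      : ∀ n → K n ⊆ˡ K (suc n)
      K-cover     : ∀ x → ∃[ n ] x ∈ˡ K n

    K-from-0 : ∀ {x} → x ∈ˡ K 0 → ∀ n → x ∈ˡ K n
    K-from-0 x∈K₀ zero    = x∈K₀
    K-from-0 x∈K₀ (suc n) = K-mono n (K-from-0 x∈K₀ n)

module Real (𝕂 : OrderedField) where
  open OrderedField 𝕂

  -- The real part of k.  It is defined for all k, with value ±∞ if k is
  -- not bounded by a rational.
  ρ : Carrier → ℝ±∞
  ρ k = sup λ q → fromℚ q ≼ k

module OrderedFieldProperties (𝕂 : OrderedField) where
  open OrderedField 𝕂
  open RingProperties ring

  ≼-refl : ∀ {x y} → x ≈ y → x ≼ y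
  ≼-refl = inj₂

  ≼-trans : ∀ {x y z} → x ≼ y → y ≼ z → x ≼ z
  ≼-trans (inj₁ p) (inj₁ q) = inj₁ (≺-trans p q)
  ≼-trans (inj₁ p) (inj₂ q) = inj₁ (≺-respʳ-≈ q p)
  ≼-trans (inj₂ p) (inj₁ q) = inj₁ (≺-respˡ-≈ (sym p) q)
  ≼-trans (inj₂ p) (inj₂ q) = inj₂ (trans p q)

  ≼-antisym : ∀ {x y} → x ≼ y → y ≼ x → x ≈ y
  ≼-antisym (inj₂ p) _        = p
  ≼-antisym (inj₁ _) (inj₂ q) = sym q
  ≼-antisym (inj₁ p) (inj₁ q) = contradiction q (≺-asym p)

  ≼⇒⊁ : ∀ {x y} → x ≼ y → ¬ (y ≺ x)
  ≼⇒⊁ (inj₁ p) q = ≺-asym p q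
  ≼⇒⊁ (inj₂ p) q = ≺-irrefl (sym p) q

  ⊁⇒≼ : ∀ {x y} → ¬ (y ≺ x) → x ≼ y
  ⊁⇒≼ {x} {y} y⊀x with compare x y
  ... | tri< p _ _ = inj₁ p
  ... | tri≈ _ p _ = inj₂ p
  ... | tri> _ _ p = contradiction p y⊀x

  +-monoʳ-≼ : ∀ x {y z} → y ≼ z → x + y ≼ x + z
  +-monoʳ-≼ x (inj₁ p) = inj₁ (+-monoʳ-≺ x p)
  +-monoʳ-≼ x (inj₂ p) = inj₂ (+-congˡ p)

  +-nonNeg : ∀ {x y} → 0# ≼ x → 0# ≼ y → 0# ≼ x + y
  +-nonNeg {x} p q =
    ≼-trans p (≼-trans (≼-refl (sym (+-identityʳ x))) (+-monoʳ-≼ x q))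

  +-pos-nonNeg : ∀ {x y} → 0# ≺ x → 0# ≼ y → 0# ≺ x + y
  +-pos-nonNeg {x} p (inj₁ q) =
    ≺-trans p (≺-respˡ-≈ (+-identityʳ x) (+-monoʳ-≺ x q))
  +-pos-nonNeg {x} p (inj₂ q) =
    ≺-respʳ-≈ (trans (sym (+-identityʳ x)) (+-congˡ q)) p

  *-nonNeg : ∀ {x y} → 0# ≼ x → 0# ≼ y → 0# ≼ x * y
  *-nonNeg (inj₁ p) (inj₁ q) = inj₁ (*-pos p q)
  *-nonNeg {x} (inj₁ p) (inj₂ q) = inj₂ (trans (sym (zeroʳ x)) (*-congˡ q))
  *-nonNeg {y = y} (inj₂ p) q = inj₂ (trans (sym (zeroˡ y)) (*-congʳ p))

  ≼⇒0≼- : ∀ {x y} → y ≼ x → 0# ≼ x - y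
  ≼⇒0≼- {x} {y} y≼x =
    ≼-trans (≼-refl (sym (-‿inverseˡ y)))
      (≼-trans (+-monoʳ-≼ (- y) y≼x) (≼-refl (+-comm (- y) x)))

  ≺⇒0≺- : ∀ {x y} → y ≺ x → 0# ≺ x - y
  ≺⇒0≺- {x} {y} y≺x =
    ≺-respˡ-≈ (-‿inverseˡ y) (≺-respʳ-≈ (+-comm (- y) x) (+-monoʳ-≺ (- y) y≺x))

  0≺1 : 0# ≺ 1#
  0≺1 with compare 0# 1#
  ... | tri< p _ _ = p
  ... | tri≈ _ p _ = contradiction (sym p) 1≉0
  ... | tri> _ _ p = contradiction p (≺-asym (≺-respʳ-≈ eq (*-pos 0≺-1 0≺-1)))
    where
    0≺-1 : 0# ≺ - 1#
    0≺-1 = ≺-respʳ-≈ (+-identityˡ (- 1#)) (≺⇒0≺- p)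
    eq : - 1# * - 1# ≈ 1#
    eq = trans (-1*x≈-x (- 1#)) (-‿involutive 1#)

  ⁻¹-inverseʳ : ∀ {x} → ¬ (x ≈ 0#) → x * x ⁻¹ ≈ 1#
  ⁻¹-inverseʳ {x} x≉0 with x ≟ 0#
  ... | yes x≈0  = contradiction x≈0 x≉0
  ... | no  x≉0′ = proj₂ (inverse x x≉0′)

  module _ {I : Set} where

    ∑-cong : ∀ (xs : List I) {f g} → (∀ x → f x ≈ g x) → ∑ xs f ≈ ∑ xs g
    ∑-cong []       f≈g = refl
    ∑-cong (x ∷ xs) f≈g = +-cong (f≈g x) (∑-cong xs f≈g)

    ∑-nonNeg : ∀ (xs : List I) {f} → (∀ x → 0# ≼ f x) → 0# ≼ ∑ xs f
    ∑-nonNeg []       0≼f = ≼-refl refl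
    ∑-nonNeg (x ∷ xs) 0≼f = +-nonNeg (0≼f x) (∑-nonNeg xs 0≼f)

    ∑-pos : ∀ (xs : List I) {f} → (∀ x → 0# ≼ f x) →
            ∀ {x} → x ∈ˡ xs → 0# ≺ f x → 0# ≺ ∑ xs f
    ∑-pos (x ∷ xs) 0≼f (here ≡.refl) 0≺fx = +-pos-nonNeg 0≺fx (∑-nonNeg xs 0≼f)
    ∑-pos (x ∷ xs) 0≼f (there y∈xs)  0≺fy =
      ≺-respʳ-≈ (+-comm _ _) (+-pos-nonNeg (∑-pos xs 0≼f y∈xs 0≺fy) (0≼f x))

    ∑-linear : ∀ (xs : List I) f t g →
               ∑ xs (λ x → f x + t * g x) ≈ ∑ xs f + t * ∑ xs g
    ∑-linear []       f t g = sym (trans (+-congˡ (zeroʳ t)) (+-identityʳ 0#))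
    ∑-linear (x ∷ xs) f t g = trans (+-congˡ (∑-linear xs f t g))
      (solve 5 (λ a t b c d → (a :+ t :* b) :+ (c :+ t :* d)
                           := (a :+ c) :+ t :* (b :+ d)) refl
        (f x) t (g x) (∑ xs f) (∑ xs g))
      where open NatSolver commutativeSemiring

module Network
  {𝕂 : OrderedField} {V : Set} (countable : V ↣ ℕ)
  (graph : WeightedGraph 𝕂 V)
  (locallyFinite : WeightedGraph.LocallyFinite graph)
  where

  open OrderedField 𝕂
  open Real 𝕂
  open WeightedGraph graph

  _≟ⱽ_ : DecidableEquality V
  _≟ⱽ_ = via-injection countable ℕ._≟_

  neighbours : V → List V
  neighbours x = proj₁ (locallyFinite x)

  -- The weighted degree b(x).  It is positive, so that the divisions below
  -- are genuine, unless x is the only vertex of a connected graph.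
  deg : V → Carrier
  deg x = ∑ (neighbours x) (b x)

  p : V → V → Carrier
  p x y = b x y * deg x ⁻¹

  π : V → V → ℝ±∞
  π x y = ρ (p x y)

  -- The unnormalised Laplacian b(x) Δ f(x).
  L : (V → Carrier) → V → Carrier
  L f x = ∑ (neighbours x) (λ y → b x y * (f x - f y))

  Δ : (V → Carrier) → V → Carrier
  Δ f x = deg x ⁻¹ * L f x

  record IsPotential (K : List V) (a : V) (v : V → Carrier) : Set where
    field
      harmonic : ∀ {x} → x ∈ˡ K → x ≢ a → Δ v x ≈ 0#
      at-a     : v a ≈ 1#
      outside  : ∀ {x} → x ∉ˡ K → v x ≈ 0#

  private
    open OrderedFieldProperties 𝕂
    open RingProperties ring using (-‿distribʳ-*; -1*x≈-x)
    open DecMembership _≟ⱽ_ using () renaming (_∈?_ to _∈ˡ?_)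

  -- `Exits I x`: there is a path from x that leaves I.
  data Exits (I : List V) (x : V) : Set where
    out  : x ∉ˡ I → Exits I x
    step : ∀ {y} → x ∼ y → Exits I y → Exits I x

  L-linear : ∀ f t g x → L (λ y → f y + t * g y) x ≈ L f x + t * L g x
  L-linear f t g x = trans
    (∑-cong (neighbours x) λ y → trans (*-congˡ (rearrange (f x) (g x) (f y) (g y)))
      (solve 4 (λ β t c d → β :* (c :+ t :* d) := β :* c :+ t :* (β :* d)) refl
        (b x y) t (f x - f y) (g x - g y)))
    (∑-linear (neighbours x) _ t _)
    where
    open NatSolver commutativeSemiring
    rearrange : ∀ c d c′ d′ → (c + t * d) - (c′ + t * d′) ≈ (c - c′) + t * (d - d′)
    rearrange c d c′ d′ = trans
      (+-congˡ (trans (sym (-‿+-comm c′ (t * d′))) (+-congˡ (-‿distribʳ-* t d′))))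
      (solve 5 (λ c t d n m → (c :+ t :* d) :+ (n :+ t :* m)
                           := (c :+ n) :+ t :* (d :+ m)) refl c t d (- c′) (- d′))
      where open AbelianGroupProperties +-abelianGroup using () renaming (⁻¹-∙-comm to -‿+-comm)

  module _ (I : List V) (exits : ∀ x → Exits I x) (f : V → Carrier)
           (f-harm : ∀ {x} → x ∈ˡ I → L f x ≈ 0#)
           (f-out  : ∀ {x} → x ∉ˡ I → f x ≈ 0#) where

    spread : ∀ {M} → 0# ≺ M → (∀ y → f y ≼ M) → ∀ {x} → Exits I x → ¬ (f x ≈ M)
    spread 0≺M f≼M (out x∉I) fx≈M = ≺-irrefl (trans (sym (f-out x∉I)) fx≈M) 0≺M
    spread {M} 0≺M f≼M {x} (step {y} x∼y e) fx≈M with x ∈ˡ? I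
    ... | no  x∉I = ≺-irrefl (trans (sym (f-out x∉I)) fx≈M) 0≺M
    ... | yes x∈I with f≼M y
    ...   | inj₂ fy≈M = spread 0≺M f≼M e fy≈M
    ...   | inj₁ fy≺M = ≺-irrefl (sym (f-harm x∈I))
            (∑-pos (neighbours x)
              (λ z → *-nonNeg (b-nonNeg x z)
                       (≼⇒0≼- (≼-trans (f≼M z) (≼-refl (sym fx≈M)))))
              (Equivalence.from (proj₂ (proj₂ (locallyFinite x)) y) x∼y)
              (*-pos x∼y (≺⇒0≺- (≺-respʳ-≈ (sym fx≈M) fy≺M))))

    maximum : ∀ J → (∀ {x} → x ∈ˡ J → f x ≼ 0#) ⊎
                    (∃[ m ] 0# ≺ f m × (∀ {x} → x ∈ˡ J → f x ≼ f m))
    maximum [] = inj₁ λ ()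
    maximum (y ∷ J) with maximum J
    maximum (y ∷ J) | inj₁ J≼0 with compare 0# (f y)
    ... | tri< 0≺fy _ _ = inj₂ (y , 0≺fy , λ
            { (here ≡.refl) → ≼-refl refl
            ; (there x∈J)   → ≼-trans (J≼0 x∈J) (inj₁ 0≺fy) })
    ... | tri≈ 0⊀fy _ _ = inj₁ λ
            { (here ≡.refl) → ⊁⇒≼ 0⊀fy ; (there x∈J) → J≼0 x∈J }
    ... | tri> 0⊀fy _ _ = inj₁ λ
            { (here ≡.refl) → ⊁⇒≼ 0⊀fy ; (there x∈J) → J≼0 x∈J }
    maximum (y ∷ J) | inj₂ (m , 0≺fm , J≼fm) with compare (f m) (f y)
    ... | tri< fm≺fy _ _ = inj₂ (y , ≺-trans 0≺fm fm≺fy , λ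
            { (here ≡.refl) → ≼-refl refl
            ; (there x∈J)   → ≼-trans (J≼fm x∈J) (inj₁ fm≺fy) })
    ... | tri≈ fm⊀fy _ _ = inj₂ (m , 0≺fm , λ
            { (here ≡.refl) → ⊁⇒≼ fm⊀fy ; (there x∈J) → J≼fm x∈J })
    ... | tri> fm⊀fy _ _ = inj₂ (m , 0≺fm , λ
            { (here ≡.refl) → ⊁⇒≼ fm⊀fy ; (there x∈J) → J≼fm x∈J })

    nonPos : ∀ x → f x ≼ 0#
    nonPos x with maximum I
    ... | inj₁ I≼0 with x ∈ˡ? I
    ...   | yes x∈I = I≼0 x∈I
    ...   | no  x∉I = ≼-refl (f-out x∉I)
    nonPos x | inj₂ (m , 0≺fm , I≼fm) = contradiction refl (spread 0≺fm f≼fm (exits m))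
      where
      f≼fm : ∀ y → f y ≼ f m
      f≼fm y with y ∈ˡ? I
      ... | yes y∈I = I≼fm y∈I
      ... | no  y∉I = ≼-trans (≼-refl (f-out y∉I)) (inj₁ 0≺fm)

  _[_↦_] : (V → Carrier) → V → Carrier → V → Carrier
  (g [ x ↦ k ]) y with y ≟ⱽ x
  ... | yes _ = k
  ... | no  _ = g y

  ↦-at : ∀ g x k → (g [ x ↦ k ]) x ≈ k
  ↦-at g x k with x ≟ⱽ x
  ... | yes _   = refl
  ... | no  x≢x = contradiction ≡.refl x≢x

  ↦-off : ∀ g {x} k {y} → y ≢ x → (g [ x ↦ k ]) y ≈ g y
  ↦-off g {x} k {y} y≢x with y ≟ⱽ x
  ... | yes y≡x = contradiction y≡x y≢x
  ... | no  _   = refl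

  exits-tail : ∀ {x I y} → Exits (x ∷ I) y → Exits I y
  exits-tail (out y∉)   = out (λ y∈I → y∉ (there y∈I))
  exits-tail (step p e) = step p (exits-tail e)

  Solution : List V → (V → Carrier) → Set
  Solution I g = ∃[ f ] (∀ {x} → x ∈ˡ I → L f x ≈ 0#) × (∀ {x} → x ∉ˡ I → f x ≈ g x)

  -- By induction on the interior: the solution for x ∷ I is a linear
  -- combination of two solutions for I.
  dirichlet : ∀ I → (∀ x → Exits I x) → ∀ g → Solution I g
  dirichlet []      _     g = g , (λ ()) , λ _ → refl
  dirichlet (x ∷ I) exits g with x ∈ˡ? I
  ... | yes x∈I =
    let f , harm , bd = dirichlet I (λ y → exits-tail (exits y)) g in
    f , (λ { (here ≡.refl) → harm x∈I ; (there y∈I) → harm y∈I })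
      , λ y∉ → bd (λ y∈I → y∉ (there y∈I))
  ... | no  x∉I = f , harm , bd
    where
    solve-I = dirichlet I (λ y → exits-tail (exits y))
    f₀ f₁ : V → Carrier
    f₀ = proj₁ (solve-I (g [ x ↦ 0# ]))
    f₁ = proj₁ (solve-I ((λ _ → 0#) [ x ↦ 1# ]))
    harm₀ : ∀ {y} → y ∈ˡ I → L f₀ y ≈ 0#
    harm₀ = proj₁ (proj₂ (solve-I _))
    harm₁ : ∀ {y} → y ∈ˡ I → L f₁ y ≈ 0#
    harm₁ = proj₁ (proj₂ (solve-I _))
    bd₀ : ∀ {y} → y ∉ˡ I → f₀ y ≈ (g [ x ↦ 0# ]) y
    bd₀ = proj₂ (proj₂ (solve-I _))
    bd₁ : ∀ {y} → y ∉ˡ I → f₁ y ≈ ((λ _ → 0#) [ x ↦ 1# ]) y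
    bd₁ = proj₂ (proj₂ (solve-I _))

    f₁x≈1 : f₁ x ≈ 1#
    f₁x≈1 = trans (bd₁ x∉I) (↦-at _ x 1#)

    Lf₁x≉0 : ¬ (L f₁ x ≈ 0#)
    Lf₁x≉0 Lf₁x≈0 = ≼⇒⊁
      (nonPos (x ∷ I) exits f₁
        (λ { (here ≡.refl) → Lf₁x≈0 ; (there y∈I) → harm₁ y∈I })
        (λ y∉ → trans (bd₁ (λ y∈I → y∉ (there y∈I)))
                      (↦-off _ 1# (λ y≡x → y∉ (here y≡x))))
        x)
      (≺-respʳ-≈ (sym f₁x≈1) 0≺1)

    d t : Carrier
    d = proj₁ (inverse (L f₁ x) Lf₁x≉0)
    t = d * - L f₀ x

    f : V → Carrier
    f y = f₀ y + t * f₁ y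

    tLf₁x : t * L f₁ x ≈ - L f₀ x
    tLf₁x = trans
      (solve 3 (λ d n l → (d :* n) :* l := (l :* d) :* n) refl d (- L f₀ x) (L f₁ x))
      (trans (*-congʳ (proj₂ (inverse (L f₁ x) Lf₁x≉0))) (*-identityˡ _))
      where open NatSolver commutativeSemiring

    harm : ∀ {y} → y ∈ˡ x ∷ I → L f y ≈ 0#
    harm (here ≡.refl) = trans (L-linear f₀ t f₁ x)
      (trans (+-congˡ tLf₁x) (-‿inverseʳ (L f₀ x)))
    harm {y} (there y∈I) = trans (L-linear f₀ t f₁ y)
      (trans (+-cong (harm₀ y∈I) (trans (*-congˡ (harm₁ y∈I)) (zeroʳ t))) (+-identityʳ 0#))

    bd : ∀ {y} → y ∉ˡ x ∷ I → f y ≈ g y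
    bd {y} y∉ = trans
      (+-cong (trans (bd₀ y∉I) (↦-off g 0# y≢x))
              (trans (*-congˡ (trans (bd₁ y∉I) (↦-off _ 1# y≢x))) (zeroʳ t)))
      (+-identityʳ (g y))
      where
      y∉I = λ y∈I → y∉ (there y∈I)
      y≢x = λ y≡x → y∉ (here y≡x)

  interior : List V → V → List V
  interior K a = filter (λ y → ¬? (y ≟ⱽ a)) K

  interior-exits : ∀ {K a} → ConnectedSet K → a ∈ˡ K → ∀ x → Exits (interior K a) x
  interior-exits {K} {a} conn a∈K x with x ∈ˡ? K
  ... | no  x∉K = out λ x∈ → x∉K (proj₁ (∈-filter⁻ (λ y → ¬? (y ≟ⱽ a)) x∈))
  ... | yes x∈K = along (conn x∈K a∈K)
    where
    along : ∀ {y} → Star (λ u w → u ∈ˡ K × w ∈ˡ K × u ∼ w) y a → Exits (interior K a) y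
    along ε = out λ a∈ → proj₂ (∈-filter⁻ (λ y → ¬? (y ≟ⱽ a)) {xs = K} a∈) ≡.refl
    along ((_ , _ , u∼w) ◅ path) = step u∼w (along path)

  potential-solution : ∀ {K a} → ConnectedSet K → a ∈ˡ K → ∃[ v ] IsPotential K a v
  potential-solution {K} {a} conn a∈K = v , record
    { harmonic = λ x∈K x≢a →
        trans (*-congˡ (v-harm (∈-filter⁺ ≢a? x∈K x≢a))) (zeroʳ _)
    ; at-a     = trans (v-bd λ a∈ → proj₂ (∈-filter⁻ ≢a? {xs = K} a∈) ≡.refl) (↦-at _ a 1#)
    ; outside  = λ {x} x∉K →
        trans (v-bd λ x∈ → x∉K (proj₁ (∈-filter⁻ ≢a? x∈)))
              (↦-off _ 1# λ { ≡.refl → x∉K a∈K })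
    }
    where
    ≢a? = λ y → ¬? (y ≟ⱽ a)
    solution = dirichlet (interior K a) (interior-exits conn a∈K) ((λ _ → 0#) [ a ↦ 1# ])
    v      = proj₁ solution
    v-harm = proj₁ (proj₂ solution)
    v-bd   = proj₂ (proj₂ solution)

  -- By `potential-unique` below, the choice of solution does not matter.
  abstract
    potential-exists : ∀ {K a} → ConnectedSet K → a ∈ˡ K → ∃[ v ] IsPotential K a v
    potential-exists = potential-solution

  potential : ∀ {K a} → ConnectedSet K → a ∈ˡ K → V → Carrier
  potential conn a∈K = proj₁ (potential-exists conn a∈K)

  deg-pos : ∀ {x y} → x ∼ y → 0# ≺ deg x
  deg-pos {x} {y} x∼y = ∑-pos (neighbours x) (b-nonNeg x)
    (Equivalence.from (proj₂ (proj₂ (locallyFinite x)) y) x∼y) x∼y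

  Δ≈0⇒L≈0 : ∀ f {x y} → x ∼ y → Δ f x ≈ 0# → L f x ≈ 0#
  Δ≈0⇒L≈0 f {x} x∼y Δ≈0 = begin
    L f x                    ≈⟨ *-identityˡ _ ⟨
    1# * L f x               ≈⟨ *-congʳ (⁻¹-inverseʳ λ deg≈0 → ≺-irrefl (sym deg≈0) (deg-pos x∼y)) ⟨
    deg x * deg x ⁻¹ * L f x ≈⟨ *-assoc _ _ _ ⟩
    deg x * Δ f x            ≈⟨ *-congˡ Δ≈0 ⟩
    deg x * 0#               ≈⟨ zeroʳ _ ⟩
    0#                       ∎
    where open SetoidReasoning setoid

  potential-unique : ∀ {K a} → ConnectedSet K → a ∈ˡ K → ∀ {v w} →
                     IsPotential K a v → IsPotential K a w → ∀ x → v x ≈ w x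
  potential-unique {K} {a} conn a∈K v-pot w-pot x =
    ≼-antisym (v≼w v-pot w-pot) (v≼w w-pot v-pot)
    where
    open IsPotential
    I = interior K a
    ≢a? = λ y → ¬? (y ≟ⱽ a)

    v≼w : ∀ {v w} → IsPotential K a v → IsPotential K a w → v x ≼ w x
    v≼w {v} {w} v-pot w-pot = ⊁⇒≼ λ wx≺vx →
      ≼⇒⊁ (nonPos I (interior-exits conn a∈K) f f-harm f-out x)
          (≺-respʳ-≈ (+-congˡ (sym (-1*x≈-x (w x)))) (≺⇒0≺- wx≺vx))
      where
      f : V → Carrier
      f y = v y + - 1# * w y

      v-w≈0 : ∀ {r s} → r ≈ s → r + - 1# * s ≈ 0#
      v-w≈0 {r} {s} r≈s = trans (+-cong r≈s (-1*x≈-x s)) (-‿inverseʳ s)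

      f-out : ∀ {y} → y ∉ˡ I → f y ≈ 0#
      f-out {y} y∉I with y ≟ⱽ a | y ∈ˡ? K
      ... | yes ≡.refl | _       = v-w≈0 (trans (at-a v-pot) (sym (at-a w-pot)))
      ... | no y≢a     | yes y∈K = contradiction (∈-filter⁺ ≢a? y∈K y≢a) y∉I
      ... | no _       | no y∉K  = v-w≈0 (trans (outside v-pot y∉K) (sym (outside w-pot y∉K)))

      L≈0 : ∀ {u} → IsPotential K a u → ∀ {y} → y ∈ˡ I → L u y ≈ 0#
      L≈0 {u} u-pot {y} y∈I with ∈-filter⁻ ≢a? {xs = K} y∈I
      ... | y∈K , y≢a with conn y∈K a∈K
      ...   | ε                 = contradiction ≡.refl y≢a
      ...   | (_ , _ , y∼z) ◅ _ = Δ≈0⇒L≈0 u y∼z (harmonic u-pot y∈K y≢a)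

      f-harm : ∀ {y} → y ∈ˡ I → L f y ≈ 0#
      f-harm {y} y∈I = trans (L-linear v (- 1#) w y)
        (v-w≈0 (trans (L≈0 v-pot y∈I) (sym (L≈0 w-pot y∈I))))

  cap : ∀ {K a} → ConnectedSet K → a ∈ˡ K → Carrier
  cap {a = a} conn a∈K = deg a * Δ (potential conn a∈K) a

  G-finite : ∀ {K a} → ConnectedSet K → a ∈ˡ K → ℝ±∞
  G-finite {a = a} conn a∈K = 1/ʳ ρ (cap conn a∈K * deg a ⁻¹)

  G : (E : Exhaustion) → let open Exhaustion E in ∀ {a} → a ∈ˡ K 0 → ℝ±∞
  G E a∈K₀ = limsup λ n → G-finite (K-connected n) (K-from-0 a∈K₀ n)
    where open Exhaustion E

{-# OPTIONS --safe #-}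
-- The potential v of K at a satisfies cap_K(a) / b(a) = 1 - Σ_y p(a,y) v(y), and by the
-- maximum principle v dominates the 𝕂-valued probabilities h_j of reaching a within j
-- steps inside K.  Since ρ(k) is a lower cut of k, the probability that the real chain
-- returns to a inside K within j + 1 steps is dominated by Σ_y p(a,y) h_j(y).  If a is
-- recurrent, these return probabilities tend to 1 along the exhaustion, by continuity
-- of P from below, so cap_{K_n}(a) / b(a) eventually drops below every positive rational.
-- Continuity yields the index n explicitly, which keeps the argument constructive.
module Submission where

open import Defs
import Algebra.Properties.AbelianGroup as AbelianGroupProperties
import Algebra.Properties.Group as GroupProperties
import Algebra.Properties.Ring as RingProperties
import Algebra.Properties.Semiring.Mult as SemiringMult
import Algebra.Solver.Ring.NaturalCoefficients.Default as NatSolver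
open import Data.Integer as ℤ using (ℤ)
import Data.Integer.Properties as ℤ
open import Data.List using (List; []; _∷_; deduplicate)
import Data.List.Extrema as Extrema
open import Data.List.Membership.Propositional using (_∈_)
open import Data.List.Membership.Propositional.Properties using (∈-deduplicate⁺; ∈-deduplicate⁻)
import Data.List.Membership.DecPropositional as DecMembership
open import Data.List.Relation.Binary.Subset.Propositional using () renaming (_⊆_ to _⊆ˡ_)
open import Data.List.Relation.Unary.All as All using (_∷_)
open import Data.List.Relation.Unary.AllPairs using (_∷_)
open import Data.List.Relation.Unary.Any using (here; there)
open import Data.List.Relation.Unary.Unique.Propositional using (Unique)
import Data.List.Relation.Unary.Unique.DecPropositional.Properties as UniqueDec
open import Data.Nat as ℕ using (ℕ; zero; suc; z≤n; s≤s)
import Data.Nat.Properties as ℕ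
open import Data.Product using (_×_; _,_; proj₁; proj₂; ∃-syntax)
open import Data.Rational as ℚ using (ℚ; mkℚ; 0ℚ; 1ℚ)
import Data.Rational.Properties as ℚ
open import Data.Rational.Unnormalised as ℚᵘ using (ℚᵘ; mkℚᵘ; *≡*)
import Data.Sign as Sign
open import Data.Sum using (_⊎_; inj₁; inj₂)
open import Data.Unit using (tt)
open import Function using (_↣_; Equivalence)
open import Level using (0ℓ)
open import Relation.Binary.Bundles using (StrictTotalOrder)
open import Relation.Binary.Construct.Closure.ReflexiveTransitive using (Star; ε; _◅_)
open import Relation.Binary.Definitions using (tri<; tri≈; tri>)
import Relation.Binary.Properties.StrictTotalOrder as StrictTotalOrderProperties
open import Relation.Binary.PropositionalEquality as ≡ using (_≡_; _≢_)
import Relation.Binary.Reasoning.Setoid as SetoidReasoning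
open import Relation.Nullary using (¬_; Dec; yes; no; contradiction)
open import Relation.Nullary.Decidable using (_×-dec_; _⊎-dec_)
open import Relation.Unary using (Pred; _⊆_; _∩_; ∁; ⋃; _⊥_; U; ∅; Decidable)

-- Order and inverses in an ordered field.

module OrderedFieldLemmas (𝕂 : OrderedField) where
  open OrderedField 𝕂
  open OrderedFieldProperties 𝕂
  open RingProperties ring using (-‿distribʳ-*; -‿distribˡ-*; -‿involutive; -0#≈0#)
  open AbelianGroupProperties +-abelianGroup using (xyx⁻¹≈y) renaming (⁻¹-∙-comm to -‿+-comm)
  open SemiringMult semiring using () renaming (_×_ to _·_; ×-homo-+ to ·-homo-+; ×1-homo-* to ·1-homo-*)
  open SetoidReasoning setoid

  strictTotalOrder : StrictTotalOrder 0ℓ 0ℓ 0ℓ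
  strictTotalOrder = record { isStrictTotalOrder = isStrictTotalOrder }

  +-mono-≼ : ∀ {w x y z} → w ≼ x → y ≼ z → w + y ≼ x + z
  +-mono-≼ {w} {x} {y} {z} w≼x y≼z = ≼-trans (+-monoʳ-≼ w y≼z)
    (≼-trans (≼-refl (+-comm w z)) (≼-trans (+-monoʳ-≼ z w≼x) (≼-refl (+-comm z x))))

  +-cancelˡ-≼ : ∀ x {y z} → x + y ≼ x + z → y ≼ z
  +-cancelˡ-≼ x x+y≼x+z = ⊁⇒≼ λ z≺y → ≼⇒⊁ x+y≼x+z (+-monoʳ-≺ x z≺y)

  *-monoˡ-≼ : ∀ {k x y} → 0# ≼ k → x ≼ y → k * x ≼ k * y
  *-monoˡ-≼ {k} {x} {y} 0≼k x≼y =
    ≼-trans (≼-refl (sym (+-identityʳ _)))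
      (≼-trans (+-monoʳ-≼ (k * x) (*-nonNeg 0≼k (≼⇒0≼- x≼y))) (≼-refl (begin
        k * x + k * (y - x) ≈⟨ distribˡ k x (y - x) ⟨
        k * (x + (y - x))   ≈⟨ *-congˡ (trans (sym (+-assoc x y (- x))) (xyx⁻¹≈y x y)) ⟩
        k * y               ∎)))

  *-mono-≼ : ∀ {w x y z} → 0# ≼ w → w ≼ x → 0# ≼ y → y ≼ z → w * y ≼ x * z
  *-mono-≼ {w} {x} {y} {z} 0≼w w≼x 0≼y y≼z = ≼-trans (*-monoˡ-≼ 0≼w y≼z)
    (≼-trans (≼-refl (*-comm w z))
      (≼-trans (*-monoˡ-≼ (≼-trans 0≼y y≼z) w≼x) (≼-refl (*-comm z x))))

  pos⇒≉0 : ∀ {x} → 0# ≺ x → ¬ (x ≈ 0#)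
  pos⇒≉0 0≺x x≈0 = ≺-irrefl (sym x≈0) 0≺x

  *-cancelʳ : ∀ {d x y} → 0# ≺ d → x * d ≈ y * d → x ≈ y
  *-cancelʳ {d} {x} {y} 0≺d xd≈yd = begin
    x              ≈⟨ undo x ⟩
    x * d * d ⁻¹   ≈⟨ *-congʳ xd≈yd ⟩
    y * d * d ⁻¹   ≈⟨ undo y ⟨
    y              ∎
    where
    undo : ∀ z → z ≈ z * d * d ⁻¹
    undo z = sym (trans (*-assoc z d (d ⁻¹))
      (trans (*-congˡ (⁻¹-inverseʳ (pos⇒≉0 0≺d))) (*-identityʳ z)))

  0⁻¹≈0 : ∀ {x} → x ≈ 0# → x ⁻¹ ≈ 0#
  0⁻¹≈0 {x} x≈0 with x ≟ 0#
  ... | yes _   = refl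
  ... | no  x≉0 = contradiction x≈0 x≉0

  ⁻¹-nonNeg : ∀ {x} → 0# ≼ x → 0# ≼ x ⁻¹
  ⁻¹-nonNeg (inj₂ 0≈x)     = ≼-refl (sym (0⁻¹≈0 (sym 0≈x)))
  ⁻¹-nonNeg {x} (inj₁ 0≺x) = ⊁⇒≼ λ x⁻¹≺0 →
    ≼⇒⊁ (≼-trans (≼-refl (sym (⁻¹-inverseʳ (pos⇒≉0 0≺x))))
                 (≼-trans (*-monoˡ-≼ (inj₁ 0≺x) (inj₁ x⁻¹≺0)) (≼-refl (zeroʳ x))))
        0≺1

  ⁻¹-pos : ∀ {x} → 0# ≺ x → 0# ≺ x ⁻¹
  ⁻¹-pos {x} 0≺x with ⁻¹-nonNeg (inj₁ 0≺x)
  ... | inj₁ 0≺x⁻¹ = 0≺x⁻¹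
  ... | inj₂ 0≈x⁻¹ = contradiction
    (trans (sym (⁻¹-inverseʳ (pos⇒≉0 0≺x))) (trans (*-congˡ (sym 0≈x⁻¹)) (zeroʳ x))) 1≉0

  -- The embedding of ℚ

  ι : ℕ → Carrier
  ι n = n · 1#

  ι-nonNeg : ∀ n → 0# ≼ ι n
  ι-nonNeg zero    = ≼-refl refl
  ι-nonNeg (suc n) = +-nonNeg (inj₁ 0≺1) (ι-nonNeg n)

  ι-pos : ∀ n → 0# ≺ ι (suc n)
  ι-pos n = +-pos-nonNeg 0≺1 (ι-nonNeg n)

  fromℤ-⊖ : ∀ m n → fromℤ (m ℤ.⊖ n) ≈ ι m - ι n
  fromℤ-⊖ m       zero    = sym (trans (+-congˡ -0#≈0#) (+-identityʳ (ι m)))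
  fromℤ-⊖ zero    (suc n) = sym (+-identityˡ _)
  fromℤ-⊖ (suc m) (suc n) = begin
    fromℤ (suc m ℤ.⊖ suc n)      ≡⟨ ≡.cong fromℤ (ℤ.[1+m]⊖[1+n]≡m⊖n m n) ⟩
    fromℤ (m ℤ.⊖ n)              ≈⟨ fromℤ-⊖ m n ⟩
    ι m - ι n                    ≈⟨ +-congˡ (xyx⁻¹≈y 1# (- ι n)) ⟨
    ι m + (1# + - ι n + - 1#)    ≈⟨ solve 4 (λ o m n p → m :+ (o :+ n :+ p)
                                      := (o :+ m) :+ (p :+ n)) refl 1# (ι m) (- ι n) (- 1#) ⟩
    ι (suc m) + (- 1# + - ι n)   ≈⟨ +-congˡ (-‿+-comm 1# (ι n)) ⟩
    ι (suc m) - ι (suc n)        ∎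
    where open NatSolver commutativeSemiring

  fromℤ-+ : ∀ i j → fromℤ (i ℤ.+ j) ≈ fromℤ i + fromℤ j
  fromℤ-+ (ℤ.+ m)    (ℤ.+ n)    = ·-homo-+ 1# m n
  fromℤ-+ (ℤ.+ m)    ℤ.-[1+ n ] = fromℤ-⊖ m (suc n)
  fromℤ-+ ℤ.-[1+ m ] (ℤ.+ n)    = trans (fromℤ-⊖ n (suc m)) (+-comm _ _)
  fromℤ-+ ℤ.-[1+ m ] ℤ.-[1+ n ] = begin
    - ι (suc (suc (m ℕ.+ n)))    ≡⟨ ≡.cong (λ k → - ι (suc k)) (ℕ.+-suc m n) ⟨
    - ι (suc m ℕ.+ suc n)        ≈⟨ -‿cong (·-homo-+ 1# (suc m) (suc n)) ⟩
    - (ι (suc m) + ι (suc n))    ≈⟨ -‿+-comm _ _ ⟨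
    - ι (suc m) + - ι (suc n)    ∎

  fromℤ-+◃ : ∀ n → fromℤ (Sign.+ ℤ.◃ n) ≈ ι n
  fromℤ-+◃ zero    = refl
  fromℤ-+◃ (suc n) = refl

  fromℤ--◃ : ∀ n → fromℤ (Sign.- ℤ.◃ n) ≈ - ι n
  fromℤ--◃ zero    = sym -0#≈0#
  fromℤ--◃ (suc n) = refl

  fromℤ-* : ∀ i j → fromℤ (i ℤ.* j) ≈ fromℤ i * fromℤ j
  fromℤ-* (ℤ.+ m)    (ℤ.+ n)    = trans (fromℤ-+◃ (m ℕ.* n)) (·1-homo-* m n)
  fromℤ-* (ℤ.+ m)    ℤ.-[1+ n ] = trans (fromℤ--◃ (m ℕ.* suc n))
    (trans (-‿cong (·1-homo-* m (suc n))) (-‿distribʳ-* _ _))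
  fromℤ-* ℤ.-[1+ m ] (ℤ.+ n)    = trans (fromℤ--◃ (suc m ℕ.* n))
    (trans (-‿cong (·1-homo-* (suc m) n)) (-‿distribˡ-* _ _))
  fromℤ-* ℤ.-[1+ m ] ℤ.-[1+ n ] = begin
    ι (suc m ℕ.* suc n)          ≈⟨ ·1-homo-* (suc m) (suc n) ⟩
    ι (suc m) * ι (suc n)        ≈⟨ -‿involutive _ ⟨
    - - (ι (suc m) * ι (suc n))  ≈⟨ -‿cong (-‿distribʳ-* _ _) ⟩
    - (ι (suc m) * - ι (suc n))  ≈⟨ -‿distribˡ-* _ _ ⟩
    - ι (suc m) * - ι (suc n)    ∎

  -- On unnormalised fractions, sums and products have explicit numerators and denominators; the
  -- laws for `fromℚ` are proved here first and then transferred along `toℚᵘ`.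
  fromℚᵘ : ℚᵘ → Carrier
  fromℚᵘ u = fromℤ (ℚᵘ.↥ u) * (ι (ℚᵘ.↧ₙ u)) ⁻¹

  -- Multiplying by the denominator reduces the laws for fractions to laws of `fromℤ`; `*-cancelʳ`
  -- then removes the denominators.
  fromℚᵘ-clear : ∀ u → fromℚᵘ u * fromℤ (ℚᵘ.↧ u) ≈ fromℤ (ℚᵘ.↥ u)
  fromℚᵘ-clear (mkℚᵘ i d) = begin
    fromℤ i * ι (suc d) ⁻¹ * ι (suc d)   ≈⟨ *-assoc _ _ _ ⟩
    fromℤ i * (ι (suc d) ⁻¹ * ι (suc d)) ≈⟨ *-congˡ (trans (*-comm _ _) (⁻¹-inverseʳ (pos⇒≉0 (ι-pos d)))) ⟩
    fromℤ i * 1#                         ≈⟨ *-identityʳ _ ⟩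
    fromℤ i                              ∎

  ↧-pos : ∀ u → 0# ≺ fromℤ (ℚᵘ.↧ u)
  ↧-pos (mkℚᵘ _ d) = ι-pos d

  fromℚᵘ-cong : ∀ {u v} → u ℚᵘ.≃ v → fromℚᵘ u ≈ fromℚᵘ v
  fromℚᵘ-cong {u} {v} (*≡* eq) =
    *-cancelʳ (*-pos (↧-pos u) (↧-pos v)) (begin
      fromℚᵘ u * (fromℤ (ℚᵘ.↧ u) * fromℤ (ℚᵘ.↧ v))   ≈⟨ *-assoc _ _ _ ⟨
      fromℚᵘ u * fromℤ (ℚᵘ.↧ u) * fromℤ (ℚᵘ.↧ v)     ≈⟨ *-congʳ (fromℚᵘ-clear u) ⟩
      fromℤ (ℚᵘ.↥ u) * fromℤ (ℚᵘ.↧ v)                ≈⟨ fromℤ-* (ℚᵘ.↥ u) (ℚᵘ.↧ v) ⟨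
      fromℤ (ℚᵘ.↥ u ℤ.* ℚᵘ.↧ v)                      ≡⟨ ≡.cong fromℤ eq ⟩
      fromℤ (ℚᵘ.↥ v ℤ.* ℚᵘ.↧ u)                      ≈⟨ fromℤ-* (ℚᵘ.↥ v) (ℚᵘ.↧ u) ⟩
      fromℤ (ℚᵘ.↥ v) * fromℤ (ℚᵘ.↧ u)                ≈⟨ *-congʳ (fromℚᵘ-clear v) ⟨
      fromℚᵘ v * fromℤ (ℚᵘ.↧ v) * fromℤ (ℚᵘ.↧ u)     ≈⟨ solve 3 (λ x y z → x :* y :* z := x :* (z :* y)) refl
                                                          (fromℚᵘ v) (fromℤ (ℚᵘ.↧ v)) (fromℤ (ℚᵘ.↧ u)) ⟩
      fromℚᵘ v * (fromℤ (ℚᵘ.↧ u) * fromℤ (ℚᵘ.↧ v))   ∎)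
    where open NatSolver commutativeSemiring

  fromℚᵘ-+ : ∀ u v → fromℚᵘ (u ℚᵘ.+ v) ≈ fromℚᵘ u + fromℚᵘ v
  fromℚᵘ-+ u@(mkℚᵘ i c) v@(mkℚᵘ j d) =
    *-cancelʳ (*-pos (ι-pos c) (ι-pos d)) (begin
      fromℚᵘ (u ℚᵘ.+ v) * (ι (suc c) * ι (suc d))
        ≈⟨ *-congˡ (·1-homo-* (suc c) (suc d)) ⟨
      fromℚᵘ (u ℚᵘ.+ v) * ι (suc c ℕ.* suc d)
        ≈⟨ fromℚᵘ-clear (u ℚᵘ.+ v) ⟩
      fromℤ (i ℤ.* ℤ.+ suc d ℤ.+ j ℤ.* ℤ.+ suc c)
        ≈⟨ fromℤ-+ (i ℤ.* ℤ.+ suc d) (j ℤ.* ℤ.+ suc c) ⟩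
      fromℤ (i ℤ.* ℤ.+ suc d) + fromℤ (j ℤ.* ℤ.+ suc c)
        ≈⟨ +-cong (fromℤ-* i _) (fromℤ-* j _) ⟩
      fromℤ i * ι (suc d) + fromℤ j * ι (suc c)
        ≈⟨ +-cong (*-congʳ (fromℚᵘ-clear u)) (*-congʳ (fromℚᵘ-clear v)) ⟨
      fromℚᵘ u * ι (suc c) * ι (suc d) + fromℚᵘ v * ι (suc d) * ι (suc c)
        ≈⟨ solve 4 (λ x y c d → x :* c :* d :+ y :* d :* c := (x :+ y) :* (c :* d)) refl
             (fromℚᵘ u) (fromℚᵘ v) (ι (suc c)) (ι (suc d)) ⟩
      (fromℚᵘ u + fromℚᵘ v) * (ι (suc c) * ι (suc d)) ∎)
    where open NatSolver commutativeSemiring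

  fromℚᵘ-* : ∀ u v → fromℚᵘ (u ℚᵘ.* v) ≈ fromℚᵘ u * fromℚᵘ v
  fromℚᵘ-* u@(mkℚᵘ i c) v@(mkℚᵘ j d) =
    *-cancelʳ (*-pos (ι-pos c) (ι-pos d)) (begin
      fromℚᵘ (u ℚᵘ.* v) * (ι (suc c) * ι (suc d))
        ≈⟨ *-congˡ (·1-homo-* (suc c) (suc d)) ⟨
      fromℚᵘ (u ℚᵘ.* v) * ι (suc c ℕ.* suc d)
        ≈⟨ fromℚᵘ-clear (u ℚᵘ.* v) ⟩
      fromℤ (i ℤ.* j)
        ≈⟨ fromℤ-* i j ⟩
      fromℤ i * fromℤ j
        ≈⟨ *-cong (fromℚᵘ-clear u) (fromℚᵘ-clear v) ⟨
      fromℚᵘ u * ι (suc c) * (fromℚᵘ v * ι (suc d))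
        ≈⟨ solve 4 (λ x y c d → x :* c :* (y :* d) := x :* y :* (c :* d)) refl
             (fromℚᵘ u) (fromℚᵘ v) (ι (suc c)) (ι (suc d)) ⟩
      fromℚᵘ u * fromℚᵘ v * (ι (suc c) * ι (suc d)) ∎)
    where open NatSolver commutativeSemiring

  fromℚ≡fromℚᵘ : ∀ q → fromℚ q ≡ fromℚᵘ (ℚ.toℚᵘ q)
  fromℚ≡fromℚᵘ (mkℚ _ _ _) = ≡.refl

  fromℚ-+ : ∀ p q → fromℚ (p ℚ.+ q) ≈ fromℚ p + fromℚ q
  fromℚ-+ p q
    rewrite fromℚ≡fromℚᵘ (p ℚ.+ q) | fromℚ≡fromℚᵘ p | fromℚ≡fromℚᵘ q =
    trans (fromℚᵘ-cong (ℚ.toℚᵘ-homo-+ p q)) (fromℚᵘ-+ (ℚ.toℚᵘ p) (ℚ.toℚᵘ q))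

  fromℚ-* : ∀ p q → fromℚ (p ℚ.* q) ≈ fromℚ p * fromℚ q
  fromℚ-* p q
    rewrite fromℚ≡fromℚᵘ (p ℚ.* q) | fromℚ≡fromℚᵘ p | fromℚ≡fromℚᵘ q =
    trans (fromℚᵘ-cong (ℚ.toℚᵘ-homo-* p q)) (fromℚᵘ-* (ℚ.toℚᵘ p) (ℚ.toℚᵘ q))

  fromℚ-0 : fromℚ 0ℚ ≈ 0#
  fromℚ-0 = zeroˡ _

  fromℚ-1 : fromℚ 1ℚ ≈ 1#
  -- Numerator and denominator of `1ℚ` both embed as `1# + 0#`.
  fromℚ-1 = ⁻¹-inverse (+-identityʳ 1#)
    where
    ⁻¹-inverse : ∀ {x} → x ≈ 1# → x * x ⁻¹ ≈ 1#
    ⁻¹-inverse x≈1 = ⁻¹-inverseʳ λ x≈0 → 1≉0 (trans (sym x≈1) x≈0)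

  fromℚ-pos : ∀ {q} → 0ℚ ℚ.< q → 0# ≺ fromℚ q
  fromℚ-pos {mkℚ (ℤ.+ suc n) d _} _ = *-pos (ι-pos n) (⁻¹-pos (ι-pos d))
  fromℚ-pos {mkℚ (ℤ.+ zero) _ _}  0<q = contradiction (ℚ.positive 0<q) λ ()
  fromℚ-pos {mkℚ ℤ.-[1+ _ ] _ _}  0<q = contradiction (ℚ.positive 0<q) λ ()

  fromℚ-mono-< : ∀ {p q} → p ℚ.< q → fromℚ p ≺ fromℚ q
  fromℚ-mono-< {p} {q} p<q = ≺-respˡ-≈ (+-identityʳ _) (≺-respʳ-≈
    (trans (sym (fromℚ-+ p (q ℚ.- p))) (reflexive (≡.cong fromℚ p+[q-p]≡q)))
    (+-monoʳ-≺ (fromℚ p) (fromℚ-pos (≡.subst (ℚ._< q ℚ.- p) (ℚ.+-inverseʳ p) (ℚ.+-monoˡ-< (ℚ.- p) p<q)))))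
    where
    p+[q-p]≡q : p ℚ.+ (q ℚ.- p) ≡ q
    p+[q-p]≡q = ≡.trans (≡.cong (p ℚ.+_) (ℚ.+-comm q (ℚ.- p)))
      (≡.trans (≡.sym (ℚ.+-assoc p (ℚ.- p) q))
        (≡.trans (≡.cong (ℚ._+ q) (ℚ.+-inverseʳ p)) (ℚ.+-identityˡ q)))

  fromℚ-cancel-≼ : ∀ {p q} → fromℚ p ≼ fromℚ q → p ℚ.≤ q
  fromℚ-cancel-≼ fp≼fq = ℚ.≮⇒≥ λ q<p → ≼⇒⊁ fp≼fq (fromℚ-mono-< q<p)

  fromℚ-mono-≤ : ∀ {p q} → p ℚ.≤ q → fromℚ p ≼ fromℚ q
  fromℚ-mono-≤ {p} {q} p≤q with ℚ.<-cmp p q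
  ... | tri< p<q _ _    = inj₁ (fromℚ-mono-< p<q)
  ... | tri≈ _ ≡.refl _ = ≼-refl refl
  ... | tri> _ _ q<p    = contradiction (ℚ.<-≤-trans q<p p≤q) (ℚ.<-irrefl ≡.refl)

  -- Finite sums.

  ∑-mono : ∀ {I : Set} (xs : List I) {f g} → (∀ {x} → x ∈ xs → f x ≼ g x) → ∑ xs f ≼ ∑ xs g
  ∑-mono []       f≼g = ≼-refl refl
  ∑-mono (x ∷ xs) f≼g = +-mono-≼ (f≼g (here ≡.refl)) (∑-mono xs (λ x∈ → f≼g (there x∈)))

  *-∑ : ∀ {I : Set} k (xs : List I) {f} → k * ∑ xs f ≈ ∑ xs (λ x → k * f x)
  *-∑ k []       = zeroʳ k
  *-∑ k (x ∷ xs) = trans (distribˡ k _ _) (+-congˡ (*-∑ k xs))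

  ∑-+ : ∀ {I : Set} (xs : List I) {f g} → ∑ xs f + ∑ xs g ≈ ∑ xs (λ x → f x + g x)
  ∑-+ []       = +-identityʳ 0#
  ∑-+ (x ∷ xs) {f} {g} = trans
    (solve 4 (λ a b c d → (a :+ b) :+ (c :+ d) := (a :+ c) :+ (b :+ d)) refl
      (f x) (∑ xs f) (g x) (∑ xs g))
    (+-congˡ (∑-+ xs))
    where open NatSolver commutativeSemiring

  module _ {I : Set} where

    -- A single occurrence of `x` is taken out, so repetitions in `ys` do no harm.
    extract : ∀ {x : I} {ys} → x ∈ ys → ∀ {f} →
              ∃[ zs ] (∀ {y} → y ∈ ys → y ≢ x → y ∈ zs) × f x + ∑ zs f ≈ ∑ ys f
    extract {ys = x ∷ ys} (here ≡.refl) = ys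
      , (λ { (here y≡x) y≢x → contradiction y≡x y≢x ; (there y∈) _ → y∈ }) , refl
    extract {x} {y ∷ ys} (there x∈ys) {f} =
      let zs , ⊆zs , eq = extract x∈ys in y ∷ zs
      , (λ { (here ≡.refl) _ → here ≡.refl ; (there z∈) z≢x → there (⊆zs z∈ z≢x) })
      , trans (solve 3 (λ a b c → a :+ (b :+ c) := b :+ (a :+ c)) refl (f x) (f y) (∑ zs f)) (+-congˡ eq)
      where open NatSolver commutativeSemiring

    -- Each positive term of the left sum is extracted from `ys` in turn; `Unique xs` ensures that
    -- the terms still to come survive the extraction. Vanishing terms are skipped.
    ∑-support-mono : ∀ {xs ys : List I} → Unique xs → ∀ {f} → (∀ x → 0# ≼ f x) →
                     (∀ {x} → x ∈ xs → 0# ≺ f x → x ∈ ys) → ∑ xs f ≼ ∑ ys f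
    ∑-support-mono {[]}     {ys} _ 0≼f _ = ∑-nonNeg ys 0≼f
    ∑-support-mono {x ∷ xs} {ys} (x∉xs ∷ unique) {f} 0≼f supp with 0≼f x
    ... | inj₂ 0≈fx = ≼-trans (≼-refl (trans (+-congʳ (sym 0≈fx)) (+-identityˡ _)))
      (∑-support-mono unique 0≼f (λ y∈ → supp (there y∈)))
    ... | inj₁ 0≺fx with extract (supp (here ≡.refl) 0≺fx)
    ...   | zs , ⊆zs , eq = ≼-trans
      (+-monoʳ-≼ (f x) (∑-support-mono unique 0≼f
        (λ y∈ 0≺fy → ⊆zs (supp (there y∈) 0≺fy) (λ y≡x → All.lookup x∉xs y∈ (≡.sym y≡x)))))
      (≼-refl eq)

-- Lower reals and probability

increasing : ∀ {I : Set} {A : ℕ → Pred I 0ℓ} → (∀ n → A n ⊆ A (suc n)) →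
             ∀ {m n} → m ℕ.≤ n → A m ⊆ A n
increasing {A = A} A-mono m≤n = go (ℕ.≤⇒≤′ m≤n)
  where
  go : ∀ {m n} → m ℕ.≤′ n → A m ⊆ A n
  go ℕ.≤′-refl       a = a
  go (ℕ.≤′-step m≤n) a = A-mono _ (go m≤n a)

x-y+y≡x : ∀ x y → (x ℚ.- y) ℚ.+ y ≡ x
x-y+y≡x x y = GroupProperties.//-rightDividesˡ ℚ.+-0-group y x

x-y<0 : ∀ {x y} → x ℚ.< y → x ℚ.- y ℚ.< 0ℚ
x-y<0 {x} {y} x<y = ≡.subst (x ℚ.- y ℚ.<_) (ℚ.+-inverseʳ y) (ℚ.+-monoˡ-< (ℚ.- y) x<y)

∈0ʳ : ∀ {q} → q ℚ.< 0ℚ → below 0ʳ q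
∈0ʳ q<0 = 0ℚ , ≡.refl , q<0

-- For q below y choose q < r < s still below y: then r = (r - s) + s, where r - s is negative and
-- hence below x. The gap q < r meets the strictness built into `sup`.
0ʳ≤+ʳ : ∀ {x y} → 0ʳ ≤ʳ x → y ≤ʳ x +ʳ y
0ʳ≤+ʳ {x} {y} 0≤x q∈y =
  let r , q<r , r∈y = rounded y q∈y
      s , r<s , s∈y = rounded y r∈y
  in (r ℚ.- s) ℚ.+ s , (r ℚ.- s , s , 0≤x (∈0ʳ (x-y<0 r<s)) , s∈y , ≡.refl)
   , ≡.subst (_ ℚ.<_) (≡.sym (x-y+y≡x r s)) q<r

≤ʳ+0ʳ : ∀ {x y} → 0ʳ ≤ʳ y → x ≤ʳ x +ʳ y
≤ʳ+0ʳ {x} {y} 0≤y q∈x with 0ʳ≤+ʳ {y} {x} 0≤y q∈x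
... | t , (r , s , r∈y , s∈x , eq) , q<t = t , (s , r , s∈x , r∈y , ≡.trans eq (ℚ.+-comm r s)) , q<t

+ʳ-mono : ∀ {w x y z} → w ≤ʳ x → y ≤ʳ z → w +ʳ y ≤ʳ x +ʳ z
+ʳ-mono w≤x y≤z (t , (r , s , r∈w , s∈y , eq) , q<t) = t , (r , s , w≤x r∈w , y≤z s∈y , eq) , q<t

x+y<x : ∀ {x y} → y ℚ.< 0ℚ → x ℚ.+ y ℚ.< x
x+y<x {x} {y} y<0 = ≡.subst (x ℚ.+ y ℚ.<_) (ℚ.+-identityʳ x) (ℚ.+-monoʳ-< x y<0)

+ʳ-≤0ʳ : ∀ {x y} → y ≤ʳ 0ʳ → x +ʳ y ≤ʳ x
+ʳ-≤0ʳ {x} {y} y≤0 (t , (r , s , r∈x , s∈y , ≡.refl) , q<t) with y≤0 s∈y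
... | _ , ≡.refl , s<0 = lower x (ℚ.<⇒≤ (ℚ.<-trans q<t (x+y<x s<0))) r∈x

0ʳ+ʳ≤ : ∀ {x} → 0ʳ +ʳ x ≤ʳ x
0ʳ+ʳ≤ {x} (t , (r , s , r∈0 , s∈x , eq) , q<t) =
  +ʳ-≤0ʳ {x} {0ʳ} (λ q∈ → q∈) (t , (s , r , s∈x , r∈0 , ≡.trans eq (ℚ.+-comm r s)) , q<t)

partialSum-mono : ∀ {x y} n → (∀ i → i ℕ.< n → x i ≤ʳ y i) → partialSum x n ≤ʳ partialSum y n
partialSum-mono zero    x≤y q∈ = q∈
partialSum-mono {x} {y} (suc n) x≤y = +ʳ-mono {partialSum x n} {partialSum y n} {x n} {y n}
  (partialSum-mono n (λ i i<n → x≤y i (ℕ.m<n⇒m<1+n i<n))) (x≤y n ℕ.≤-refl)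

partialSum≤series : ∀ x n → partialSum x n ≤ʳ series x
partialSum≤series x n q∈ =
  let r , q<r , r∈ = rounded (partialSum x n) q∈ in r , (n , r∈) , q<r

series⇒partialSum : ∀ x {q} → below (series x) q → ∃[ n ] below (partialSum x n) q
series⇒partialSum x (r , (n , r∈) , q<r) = n , lower (partialSum x n) (ℚ.<⇒≤ q<r) r∈

-- Null events, splitting and continuity in a probability space.

module Measure (S : ProbabilitySpace) where
  open ProbabilitySpace S

  ∅-event : Event ∅
  ∅-event = ≐-event ((λ ¬U → ¬U tt) , λ ()) (∁-event U-event)

  ∩-event : ∀ {A B} → Event A → Event B → Event (A ∩ B)
  ∩-event {A} {B} A-event B-event =
    ≐-event ((λ AB → AB 0 , AB 1) , λ { (a , b) zero → a ; (a , b) (suc _) → b })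
      (⋂-event {C} λ { zero → A-event ; (suc _) → B-event })
    where
    C : ℕ → Pred Ω 0ℓ
    C zero    = A
    C (suc _) = B

  ×-event : ∀ {Q : Set} {A} → Dec Q → Event A → Event (λ ω → Q × A ω)
  ×-event (yes q) A-event = ≐-event ((λ a → q , a) , proj₂) A-event
  ×-event (no ¬q) A-event = ≐-event ((λ ()) , λ (q , _) → contradiction q ¬q) ∅-event

  ∪-event : ∀ {A B} → Event A → Event B → Event (λ ω → A ω ⊎ B ω)
  ∪-event {A} {B} A-event B-event =
    ≐-event ((λ { (zero , a) → inj₁ a ; (suc _ , b) → inj₂ b })
            , λ { (inj₁ a) → 0 , a ; (inj₂ b) → 1 , b })
      (⋃-event {C} λ { zero → A-event ; (suc _) → B-event })
    where
    C : ℕ → Pred Ω 0ℓ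
    C zero    = A
    C (suc _) = B

  -- Finite additivity comes from countable additivity by cutting off: `D′ i` agrees with `D i` for
  -- i < n and is empty afterwards, and the union of these events lies in `E`.
  P-partialSum : ∀ {D : ℕ → Pred Ω 0ℓ} → (∀ n → Event (D n)) → (∀ {m n} → m ≢ n → D m ⊥ D n) →
                 ∀ n {E} → Event E → (∀ {i} → i ℕ.< n → D i ⊆ E) →
                 partialSum (λ i → P (D i)) n ≤ʳ P E
  P-partialSum {D} D-event D-disjoint n {E} E-event D⊆E q∈ =
    P-mono (⋃-event D′-event) E-event (λ (i , i<n , d) → D⊆E i<n d)
      (proj₂ (P-⋃ D′-event λ m≢n ((_ , d) , (_ , e)) → D-disjoint m≢n (d , e))
        (partialSum≤series (λ i → P (D′ i)) n
          (partialSum-mono n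
            (λ i i<n → P-mono (D-event i) (D′-event i) (λ d → i<n , d)) q∈)))
    where
    D′ : ℕ → Pred Ω 0ℓ
    D′ i ω = i ℕ.< n × D i ω
    D′-event : ∀ i → Event (D′ i)
    D′-event i = ×-event (i ℕ.<? n) (D-event i)

  -- Padding with `∅` lets countable additivity speak about two disjoint events.
  pair : Pred Ω 0ℓ → Pred Ω 0ℓ → ℕ → Pred Ω 0ℓ
  pair A B zero          = A
  pair A B (suc zero)    = B
  pair A B (suc (suc _)) = ∅

  pair-event : ∀ {A B} → Event A → Event B → ∀ n → Event (pair A B n)
  pair-event A-event B-event zero          = A-event
  pair-event A-event B-event (suc zero)    = B-event
  pair-event A-event B-event (suc (suc _)) = ∅-event

  pair-disjoint : ∀ {A B} → A ⊥ B → ∀ {m n} → m ≢ n → pair A B m ⊥ pair A B n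
  pair-disjoint A⊥B {zero}        {zero}        m≢n _       = m≢n ≡.refl
  pair-disjoint A⊥B {zero}        {suc zero}    m≢n ab      = A⊥B ab
  pair-disjoint A⊥B {suc zero}    {zero}        m≢n (b , a) = A⊥B (a , b)
  pair-disjoint A⊥B {suc zero}    {suc zero}    m≢n _       = m≢n ≡.refl
  pair-disjoint A⊥B {zero}        {suc (suc _)} m≢n (_ , ())
  pair-disjoint A⊥B {suc zero}    {suc (suc _)} m≢n (_ , ())
  pair-disjoint A⊥B {suc (suc _)}               m≢n (() , _)

  -- If some r > 0 were below `P B`, then u = 1 - r would be below `P A`, and adding some s > r that
  -- is still below `P B` would give more than 1, against additivity.
  P-null : ∀ {A B} → Event A → Event B → P A ≈ʳ 1ʳ → A ⊥ B → P B ≤ʳ 0ʳ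
  P-null {A} {B} A-event B-event (_ , 1≤PA) A⊥B {q} q∈PB =
    let r , q<r , r∈PB = rounded (P B) q∈PB in ∈0ʳ (ℚ.<-≤-trans q<r (r≤0 r∈PB))
    where
    r≤0 : ∀ {r} → below (P B) r → r ℚ.≤ 0ℚ
    r≤0 {r} r∈PB = ℚ.≮⇒≥ λ 0<r →
      let u = 1ℚ ℚ.- r
          s , r<s , s∈PB = rounded (P B) r∈PB
          u<1   = x+y<x (ℚ.neg-antimono-< 0<r)
          u∈PA  = 1≤PA (1ℚ , ≡.refl , u<1)
          1<u+s = ≡.subst (ℚ._< u ℚ.+ s) (x-y+y≡x 1ℚ r) (ℚ.+-monoʳ-< u r<s)
          1∈Σ   = u ℚ.+ s , (u , s , 0ʳ≤+ʳ {0ʳ} {P A} (λ q∈ → q∈) u∈PA , s∈PB , ≡.refl) , 1<u+s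
          _ , t≡1 , 1<t = proj₁ P-U
            (P-partialSum (pair-event A-event B-event) (pair-disjoint A⊥B) 2 U-event (λ _ _ → tt) 1∈Σ)
      in ℚ.<-irrefl (≡.sym t≡1) 1<t

  P-∅ : ∀ {A} → Event A → (∀ {ω} → ¬ A ω) → P A ≤ʳ 0ʳ
  P-∅ A-event ¬A = P-null U-event A-event P-U λ (_ , a) → ¬A a

  P-split : ∀ {A B} → Event A → Event B → Decidable B → P A ≤ʳ P (A ∩ B) +ʳ P (A ∩ ∁ B)
  P-split {A} {B} A-event B-event B? q∈PA =
    let n , q∈ = series⇒partialSum (λ i → P (D i))
                   (proj₁ (P-⋃ D-event (pair-disjoint λ ((_ , b) , (_ , ¬b)) → ¬b b))
                     (P-mono A-event (⋃-event D-event) A⊆⋃D q∈PA))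
    -- The index n is arbitrary, so the partial sum is enlarged to 2 + n terms by `grow`, and the
    -- null terms after the first two are stripped by `tail`.
    in +ʳ-mono {0ʳ +ʳ P A∩B} {P A∩B} {P A∩∁B} {P A∩∁B}
         (0ʳ+ʳ≤ {P A∩B}) (λ q∈ → q∈) (tail n (grow (suc n) (grow n q∈)))
    where
    A∩B A∩∁B : Pred Ω 0ℓ
    A∩B  = A ∩ B
    A∩∁B = A ∩ ∁ B
    D : ℕ → Pred Ω 0ℓ
    D = pair A∩B A∩∁B
    D-event : ∀ n → Event (D n)
    D-event = pair-event (∩-event A-event B-event) (∩-event A-event (∁-event B-event))
    A⊆⋃D : A ⊆ ⋃ ℕ D
    A⊆⋃D {ω} a with B? ω
    ... | yes b = 0 , a , b
    ... | no ¬b = 1 , a , ¬b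
    Σ[D] : ℕ → ℝ±∞
    Σ[D] = partialSum (λ i → P (D i))
    grow : ∀ n → Σ[D] n ≤ʳ Σ[D] (suc n)
    grow n = ≤ʳ+0ʳ {Σ[D] n} {P (D n)} (P-nonNeg (D-event n))
    tail : ∀ n → Σ[D] (2 ℕ.+ n) ≤ʳ Σ[D] 2
    tail zero    q∈ = q∈
    tail (suc n) q∈ = tail n (+ʳ-≤0ʳ {Σ[D] (2 ℕ.+ n)} {P (D (2 ℕ.+ n))} (P-∅ ∅-event (λ ())) q∈)

  -- `D` takes the disjoint increments of `A`. A rational below `P B` is already below a finite
  -- partial sum of their probabilities, and those increments lie in one `A n`. Deciding `A n`
  -- locates the increment that contains a given outcome.
  P-continuity : ∀ {A : ℕ → Pred Ω 0ℓ} → (∀ n → Event (A n)) → (∀ n → Decidable (A n)) →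
                 (∀ n → A n ⊆ A (suc n)) → ∀ {B} → Event B → B ⊆ ⋃ ℕ A →
                 ∀ {q} → below (P B) q → ∃[ n ] below (P (A n)) q
  P-continuity {A} A-event A? A-mono {B} B-event B⊆⋃A q∈PB =
    let n , q∈ = series⇒partialSum (λ i → P (D i))
                   (proj₁ (P-⋃ D-event disjoint)
                     (P-mono B-event (⋃-event D-event) (λ b → let m , a = B⊆⋃A b in first m a) q∈PB))
    in n , P-partialSum D-event disjoint n (A-event n)
           (λ {i} i<n d → increasing A-mono (ℕ.<⇒≤ i<n) (D⊆A i d)) q∈
    where
    D : ℕ → Pred Ω 0ℓ
    D zero    = A 0
    D (suc n) = A (suc n) ∩ ∁ (A n)
    D-event : ∀ n → Event (D n)
    D-event zero    = A-event 0
    D-event (suc n) = ∩-event (A-event (suc n)) (∁-event (A-event n))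
    D⊆A : ∀ n → D n ⊆ A n
    D⊆A zero    d = d
    D⊆A (suc n) d = proj₁ d
    earlier : ∀ {m n} → m ℕ.< n → D m ⊥ D n
    earlier {m} {suc n} (s≤s m≤n) (dm , (_ , ¬an)) = ¬an (increasing A-mono m≤n (D⊆A m dm))
    disjoint : ∀ {m n} → m ≢ n → D m ⊥ D n
    disjoint {m} {n} m≢n (dm , dn) with ℕ.<-cmp m n
    ... | tri< m<n _ _ = earlier m<n (dm , dn)
    ... | tri≈ _ m≡n _ = m≢n m≡n
    ... | tri> _ _ n<m = earlier n<m (dn , dm)
    first : ∀ {ω} n → A n ω → ∃[ m ] D m ω
    first zero    a = 0 , a
    first {ω} (suc n) a with A? n ω
    ... | yes a′ = first n a′
    ... | no ¬a′ = suc n , a , ¬a′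

-- Comparison of lower reals with field elements.

module Domination (𝕂 : OrderedField) where
  open OrderedField 𝕂
  open OrderedFieldProperties 𝕂
  open OrderedFieldLemmas 𝕂
  open Real 𝕂

  infix 4 _⊑_
  -- Real numbers are bounded by elements of `𝕂` through the rationals, with no common extension
  -- field; `k` may fall short of `x` by an infinitesimal.
  record _⊑_ (x : ℝ±∞) (k : Carrier) : Set where
    constructor dominated
    field below-≼ : ∀ {q} → below x q → fromℚ q ≼ k
  open _⊑_ public

  ⊑-respˡ-≤ʳ : ∀ {x y k} → x ≤ʳ y → y ⊑ k → x ⊑ k
  ⊑-respˡ-≤ʳ x≤y y⊑k .below-≼ q∈x = below-≼ y⊑k (x≤y q∈x)

  ⊑-respʳ-≈ : ∀ {x k l} → k ≈ l → x ⊑ k → x ⊑ l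
  ⊑-respʳ-≈ k≈l x⊑k .below-≼ q∈x = ≼-trans (below-≼ x⊑k q∈x) (≼-refl k≈l)

  ⊑-0ʳ : 0ʳ ⊑ 0#
  ⊑-0ʳ .below-≼ (_ , ≡.refl , q<0) = ≼-trans (inj₁ (fromℚ-mono-< q<0)) (≼-refl fromℚ-0)

  ⊑-1ʳ : 1ʳ ⊑ 1#
  ⊑-1ʳ .below-≼ (_ , ≡.refl , q<1) = ≼-trans (inj₁ (fromℚ-mono-< q<1)) (≼-refl fromℚ-1)

  ⊑-ρ : ∀ k → ρ k ⊑ k
  ⊑-ρ k .below-≼ (t , ft≼k , q<t) = ≼-trans (inj₁ (fromℚ-mono-< q<t)) ft≼k

  ⊑-+ : ∀ {x y k l} → x ⊑ k → y ⊑ l → x +ʳ y ⊑ k + l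
  ⊑-+ x⊑k y⊑l .below-≼ (_ , (s , t , s∈x , t∈y , ≡.refl) , q<s+t) =
    ≼-trans (inj₁ (fromℚ-mono-< q<s+t))
      (≼-trans (≼-refl (fromℚ-+ s t)) (+-mono-≼ (below-≼ x⊑k s∈x) (below-≼ y⊑l t∈y)))

  ⊑-* : ∀ {x y k l} → 0# ≼ k → 0# ≼ l → x ⊑ k → y ⊑ l → x *ʳ y ⊑ k * l
  -- The clause `q ≡ 0ℚ` puts every negative rational into the product cut; the signs of `k` and `l`
  -- take care of these.
  ⊑-* 0≼k 0≼l _ _ .below-≼ (_ , inj₁ ≡.refl , q<0) = ≼-trans (inj₁ (fromℚ-mono-< q<0))
    (≼-trans (≼-refl fromℚ-0) (*-nonNeg 0≼k 0≼l))
  ⊑-* _ _ x⊑k y⊑l .below-≼ (_ , inj₂ (s , t , (0≤s , s∈x) , (0≤t , t∈y) , ≡.refl) , q<st) =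
    ≼-trans (inj₁ (fromℚ-mono-< q<st)) (≼-trans (≼-refl (fromℚ-* s t))
      (*-mono-≼ (nonNeg 0≤s) (below-≼ x⊑k s∈x) (nonNeg 0≤t) (below-≼ y⊑l t∈y)))
    where
    nonNeg : ∀ {r} → 0ℚ ℚ.≤ r → 0# ≼ fromℚ r
    nonNeg 0≤r = ≼-trans (≼-refl (sym fromℚ-0)) (fromℚ-mono-≤ 0≤r)

  module _ (S : ProbabilitySpace) where
    open ProbabilitySpace S
    open Measure S

    P-mono-⊑ : ∀ {A B k} → Event A → Event B → A ⊆ B → P B ⊑ k → P A ⊑ k
    P-mono-⊑ A-event B-event A⊆B = ⊑-respˡ-≤ʳ (P-mono A-event B-event A⊆B)

    P-∅-⊑ : ∀ {A} → Event A → (∀ {ω} → ¬ A ω) → P A ⊑ 0#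
    P-∅-⊑ A-event ¬A = ⊑-respˡ-≤ʳ (P-∅ A-event ¬A) ⊑-0ʳ

    P-split-⊑ : ∀ {A B k l} → Event A → Event B → Decidable B →
                P (A ∩ B) ⊑ k → P (A ∩ ∁ B) ⊑ l → P A ⊑ k + l
    P-split-⊑ A-event B-event B? A∩B⊑k A∩∁B⊑l =
      ⊑-respˡ-≤ʳ (P-split A-event B-event B?) (⊑-+ A∩B⊑k A∩∁B⊑l)

-- Potentials and hitting probabilities

module NetworkLemmas
  {𝕂 : OrderedField} {V : Set} (countable : V ↣ ℕ)
  (graph : WeightedGraph 𝕂 V)
  (locallyFinite : WeightedGraph.LocallyFinite graph)
  where

  open OrderedField 𝕂
  open OrderedFieldProperties 𝕂
  open OrderedFieldLemmas 𝕂
  open Domination 𝕂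
  open Real 𝕂
  open WeightedGraph graph
  open Network countable graph locallyFinite
  open SetoidReasoning setoid hiding (start)
  open DecMembership _≟ⱽ_ using () renaming (_∈?_ to _∈ˡ?_)

  ∼⇒∈neighbours : ∀ {x y} → x ∼ y → y ∈ neighbours x
  ∼⇒∈neighbours {x} {y} = Equivalence.from (proj₂ (proj₂ (locallyFinite x)) y)

  deg-nonNeg : ∀ x → 0# ≼ deg x
  deg-nonNeg x = ∑-nonNeg (neighbours x) (b-nonNeg x)

  p-nonNeg : ∀ x y → 0# ≼ p x y
  p-nonNeg x y = *-nonNeg (b-nonNeg x y) (⁻¹-nonNeg (deg-nonNeg x))

  -- The weights p(x,y) sum to 1. The additive form keeps subtraction out of the later inequalities.
  Δ+average : ∀ f {x} → ¬ (deg x ≈ 0#) → Δ f x + ∑ (neighbours x) (λ y → p x y * f y) ≈ f x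
  Δ+average f {x} deg≉0 = begin
    Δ f x + ∑ N (λ y → p x y * f y)
      ≈⟨ +-cong (*-∑ (deg x ⁻¹) N) refl ⟩
    ∑ N (λ y → deg x ⁻¹ * (b x y * (f x - f y))) + ∑ N (λ y → p x y * f y)
      ≈⟨ ∑-+ N ⟩
    ∑ N (λ y → deg x ⁻¹ * (b x y * (f x - f y)) + p x y * f y)
      -- Term by term, the parts that contain `f y` cancel.
      ≈⟨ ∑-cong N (λ y → trans
           (solve 5 (λ i β s t n → i :* (β :* (s :+ n)) :+ β :* i :* t := i :* s :* β :+ i :* β :* (n :+ t)) refl
             (deg x ⁻¹) (b x y) (f x) (f y) (- f y))
           (trans (+-congˡ (trans (*-congˡ (-‿inverseˡ (f y))) (zeroʳ _))) (+-identityʳ _))) ⟩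
    ∑ N (λ y → deg x ⁻¹ * f x * b x y)
      ≈⟨ *-∑ (deg x ⁻¹ * f x) N ⟨
    deg x ⁻¹ * f x * deg x
      ≈⟨ solve 3 (λ i s d → i :* s :* d := d :* i :* s) refl (deg x ⁻¹) (f x) (deg x) ⟩
    deg x * deg x ⁻¹ * f x
      ≈⟨ *-congʳ (⁻¹-inverseʳ deg≉0) ⟩
    1# * f x
      ≈⟨ *-identityˡ _ ⟩
    f x ∎
    where
    open NatSolver commutativeSemiring
    N = neighbours x

  -- At a minimum every term of - L f x is nonnegative, so a neighbour with a strictly larger value
  -- would make the sum positive.
  harmonic-minimum : ∀ f {x y} → L f x ≈ 0# → (∀ z → f x ≼ f z) → x ∼ y → f y ≈ f x
  harmonic-minimum f {x} {y} Lf≈0 min x∼y with min y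
  ... | inj₂ fx≈fy = sym fx≈fy
  ... | inj₁ fx≺fy = contradiction
    (∑-pos N (λ z → *-nonNeg (b-nonNeg x z) (≼⇒0≼- (min z))) (∼⇒∈neighbours x∼y)
      (*-pos x∼y (≺⇒0≺- fx≺fy)))
    (≺-irrefl (sym (begin
      ∑ N (λ z → b x z * (f z - f x))           ≈⟨ +-identityˡ _ ⟨
      0# + ∑ N (λ z → b x z * (f z - f x))      ≈⟨ +-congʳ Lf≈0 ⟨
      L f x + ∑ N (λ z → b x z * (f z - f x))   ≈⟨ ∑-+ N ⟩
      ∑ N (λ z → b x z * (f x - f z) + b x z * (f z - f x))
        ≈⟨ ∑-cong N (λ z → trans
             (solve 5 (λ β s t m n → β :* (s :+ n) :+ β :* (t :+ m) := β :* ((s :+ m) :+ (t :+ n))) refl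
               (b x z) (f x) (f z) (- f x) (- f z))
             (trans (*-congˡ (trans (+-cong (-‿inverseʳ (f x)) (-‿inverseʳ (f z))) (+-identityʳ 0#)))
               (trans (zeroʳ (b x z)) (sym (zeroˡ (b x z)))))) ⟩
      ∑ N (λ z → 0# * b x z)                    ≈⟨ *-∑ 0# N ⟨
      0# * deg x                                ≈⟨ zeroˡ _ ⟩
      0#                                        ∎)))
    where
    open NatSolver commutativeSemiring
    N = neighbours x

  module _ {K a} (conn : ConnectedSet K) (a∈K : a ∈ K) {v} (pot : IsPotential K a v) where
    open IsPotential pot

    -- The path in `K` from `x` to `a` begins with an edge at `x`.
    deg≉0 : ∀ {x} → x ∈ K → x ≢ a → ¬ (deg x ≈ 0#)
    deg≉0 x∈K x≢a with conn x∈K a∈K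
    ... | ε                 = contradiction ≡.refl x≢a
    ... | (_ , _ , x∼y) ◅ _ = pos⇒≉0 (deg-pos x∼y)

    -- Minimum principle: a negative minimum over `K` would spread along a path to `a`, where `v`
    -- equals 1.
    potential-nonNeg : ∀ x → 0# ≼ v x
    potential-nonNeg x with x ∈ˡ? K
    ... | no  x∉K = ≼-refl (sym (outside x∉K))
    ... | yes x∈K = ≼-trans 0≼vm (m≼ x∈K)
      where
      open Extrema (StrictTotalOrderProperties.totalOrder strictTotalOrder)

      m : V
      m = argmin v a K

      m∈K : m ∈ K
      m∈K = argmin-all v {P = _∈ K} a∈K (All.tabulate λ z∈K → z∈K)

      m≼ : ∀ {z} → z ∈ K → v m ≼ v z
      m≼ = All.lookup (f[argmin]≤f[xs] a K)

      0≼vm : 0# ≼ v m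
      0≼vm = ⊁⇒≼ λ vm≺0 → along vm≺0 (conn m∈K a∈K) refl
        where
        along : v m ≺ 0# → ∀ {z} → Star (λ u w → u ∈ K × w ∈ K × u ∼ w) z a → ¬ (v z ≈ v m)
        along vm≺0 {z} path vz≈vm with z ≟ⱽ a
        along vm≺0 path vz≈vm | yes ≡.refl =
          ≺-asym 0≺1 (≺-respˡ-≈ (trans (sym vz≈vm) at-a) vm≺0)
        along vm≺0 ε vz≈vm | no a≢a = a≢a ≡.refl
        along vm≺0 {z} ((z∈K , _ , z∼w) ◅ path) vz≈vm | no z≢a =
          along vm≺0 path (trans (harmonic-minimum v (Δ≈0⇒L≈0 v z∼w (harmonic z∈K z≢a)) global z∼w) vz≈vm)
          where
          -- Outside `K` the value 0 exceeds the negative minimum, so the minimum over `K` is a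
          -- global one.
          global : ∀ y → v z ≼ v y
          global y with y ∈ˡ? K
          ... | yes y∈K = ≼-trans (≼-refl vz≈vm) (m≼ y∈K)
          ... | no  y∉K = ≼-trans (≼-refl vz≈vm) (≼-trans (inj₁ vm≺0) (≼-refl (sym (outside y∉K))))

  -- Hitting probabilities inside a finite set, compared with the potential.

  module Hitting (K : List V) (a : V) where

    -- The list `K` may repeat vertices, but each has to count once in a sum.
    S : List V
    S = deduplicate _≟ⱽ_ K

    -- Only vertices of `K` enter the sum, so the walk is killed on leaving `K`.
    average : (V → Carrier) → V → Carrier
    average f x = ∑ S (λ y → p x y * f y)

    -- The 𝕂-valued probability of reaching a from x within j steps inside K.
    hit : ℕ → V → Carrier
    hit j x with x ≟ⱽ a
    hit j       x | yes _ = 1#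
    hit zero    x | no  _ = 0#
    hit (suc j) x | no  _ = average (hit j) x

    module _ (conn : ConnectedSet K) (a∈K : a ∈ K) {v} (pot : IsPotential K a v) where
      open IsPotential pot

      -- Vertices of `K` that are not adjacent to `x` contribute 0, and the neighbours outside `K`
      -- add nonnegative terms.
      average≼neighbours : ∀ {f} → (∀ {y} → y ∈ K → f y ≼ v y) →
                           ∀ x → average f x ≼ ∑ (neighbours x) (λ y → p x y * v y)
      average≼neighbours f≼v x = ≼-trans
        (∑-mono S (λ y∈S → *-monoˡ-≼ (p-nonNeg x _) (f≼v (∈-deduplicate⁻ _≟ⱽ_ K y∈S))))
        (∑-support-mono (UniqueDec.deduplicate-! _≟ⱽ_ K)
          (λ y → *-nonNeg (p-nonNeg x y) (potential-nonNeg conn a∈K pot y))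
          (λ _ 0≺pv → ∼⇒∈neighbours (edge 0≺pv)))
        where
        edge : ∀ {y} → 0# ≺ p x y * v y → x ∼ y
        edge {y} 0≺pv with b-nonNeg x y
        ... | inj₁ x∼y = x∼y
        ... | inj₂ 0≈b = contradiction
          (sym (trans (*-congʳ (trans (*-congʳ (sym 0≈b)) (zeroˡ _))) (zeroˡ (v y))))
          (λ 0≈pv → ≺-irrefl 0≈pv 0≺pv)

      -- Induction on j: away from `a`, harmonicity makes `v` the average of its values at the
      -- neighbours, which parallels the recursion of `hit`; the start at 0 is covered by
      -- nonnegativity of `v`.
      hit≼potential : ∀ j {x} → x ∈ K → hit j x ≼ v x
      hit≼potential j {x} x∈K with x ≟ⱽ a
      hit≼potential j       x∈K | yes ≡.refl = ≼-refl (sym at-a)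
      hit≼potential zero    x∈K | no  _      = potential-nonNeg conn a∈K pot _
      hit≼potential (suc j) {x} x∈K | no x≢a = ≼-trans
        (average≼neighbours (hit≼potential j) x)
        (≼-refl (trans (sym (+-identityˡ _)) (trans (+-congʳ (sym (harmonic x∈K x≢a)))
          (Δ+average v (deg≉0 conn a∈K pot x∈K x≢a)))))

      -- Δ v a is 1 minus the average of `v` over the neighbours of `a`, and that average is at
      -- least `k`; `l` stands for 1 - k.
      return+escape : ∀ j {k l} → 0# ≼ l → k + l ≈ 1# → k ≼ average (hit j) a →
                      deg a * Δ v a * deg a ⁻¹ ≼ l
      return+escape j {k} {l} 0≼l k+l≈1 k≼ = split (deg a ≟ 0#)
        where
        open NatSolver commutativeSemiring
        split : Dec (deg a ≈ 0#) → deg a * Δ v a * deg a ⁻¹ ≼ l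
        -- In degree zero the factor `deg a` makes the left side 0.
        split (yes deg≈0) = ≼-trans
          (≼-refl (trans (*-congʳ (trans (*-congʳ deg≈0) (zeroˡ _))) (zeroˡ _))) 0≼l
        split (no  deg≉0) = ≼-trans
          (≼-refl (begin
            deg a * Δ v a * deg a ⁻¹   ≈⟨ solve 3 (λ d e i → d :* e :* i := e :* (d :* i)) refl
                                            (deg a) (Δ v a) (deg a ⁻¹) ⟩
            Δ v a * (deg a * deg a ⁻¹) ≈⟨ *-congˡ (⁻¹-inverseʳ deg≉0) ⟩
            Δ v a * 1#                 ≈⟨ *-identityʳ _ ⟩
            Δ v a                      ∎))
          (+-cancelˡ-≼ k (≼-trans
            (+-mono-≼ (≼-trans k≼ (average≼neighbours (hit≼potential j) a)) (≼-refl refl))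
            (≼-refl (trans (+-comm _ _) (trans (Δ+average v deg≉0) (trans at-a (sym k+l≈1)))))))

  -- Events and return probabilities of the chain.

  module ChainLemmas {a : V} (chain : MarkovChain π a) where
    open MarkovChain chain
    open Measure space

    X∈-event : ∀ n ys → Event (λ ω → X n ω ∈ ys)
    X∈-event n []       = ≐-event ((λ ()) , λ ()) ∅-event
    X∈-event n (y ∷ ys) = ≐-event
      ( (λ { (inj₁ X≡y) → here X≡y ; (inj₂ X∈ys) → there X∈ys })
      , (λ { (here X≡y) → inj₁ X≡y ; (there X∈ys) → inj₂ X∈ys }))
      (∪-event (X-event n y) (X∈-event n ys))

    History-event : ∀ n y → Event (History n y)
    History-event n y = ⋂-event at
      where
      at : ∀ i → Event (λ ω → i ℕ.≤ n → X i ω ≡ y i)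
      at i with i ℕ.≤? n
      ... | yes i≤n = ≐-event ((λ X≡y _ → X≡y) , λ X≡y → X≡y i≤n) (X-event i (y i))
      ... | no  i≰n = ≐-event ((λ _ i≤n → contradiction i≤n i≰n) , λ _ → tt) U-event

    InfinitelyOften-event : ∀ x → Event (InfinitelyOften x)
    InfinitelyOften-event x =
      ⋂-event λ m → ⋃-event λ n → ×-event (m ℕ.≤? n) (X-event n x)

    extend : ℕ → (ℕ → V) → V → ℕ → V
    extend n y z i with i ℕ.≤? n
    ... | yes _ = y i
    ... | no  _ = z

    extend-≤ : ∀ {n} y z {i} → i ℕ.≤ n → extend n y z i ≡ y i
    extend-≤ {n} y z {i} i≤n with i ℕ.≤? n
    ... | yes _   = ≡.refl
    ... | no  i≰n = contradiction i≤n i≰n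

    extend-> : ∀ n y z → extend n y z (suc n) ≡ z
    extend-> n y z with suc n ℕ.≤? n
    ... | yes n<n = contradiction n<n (ℕ.<-irrefl ≡.refl)
    ... | no  _   = ≡.refl

    History-extend : ∀ n y z {ω} → History n y ω → X (suc n) ω ≡ z → History (suc n) (extend n y z) ω
    History-extend n y z H X≡z i i≤1+n with i ℕ.≤? n
    ... | yes i≤n = H i i≤n
    ... | no  i≰n with ℕ.≤-antisym i≤1+n (ℕ.≰⇒> i≰n)
    ...   | ≡.refl = X≡z

    -- The Markov property as an upper bound: one more state multiplies the bound by the value of
    -- `p`, which dominates its own real part.
    P-History-extend : ∀ n y z {k} → 0# ≼ k → P (History n y) ⊑ k →
                       P (History (suc n) (extend n y z)) ⊑ k * p (y n) z
    P-History-extend n y z {k} 0≼k H⊑k = ⊑-respʳ-≈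
      (*-congˡ (reflexive (≡.cong₂ p (extend-≤ y z ℕ.≤-refl) (extend-> n y z))))
      (⊑-respˡ-≤ʳ (proj₁ (markov n y′))
        (⊑-* 0≼k (p-nonNeg _ _)
          (P-mono-⊑ space (History-event n y′) (History-event n y)
            (λ H i i≤n → ≡.trans (H i i≤n) (extend-≤ y z i≤n)) H⊑k)
          (⊑-ρ (p (y′ n) (y′ (suc n))))))
      where
      y′ = extend n y z

    -- The values in `ys` are split off one at a time, each by deciding an equality of vertices.
    P-∑ : ∀ n ys {C f} → Event C → (∀ y → P (λ ω → C ω × X n ω ≡ y) ⊑ f y) →
          P (λ ω → C ω × X n ω ∈ ys) ⊑ ∑ ys f
    P-∑ n [] C-event C⊑f =
      P-∅-⊑ space (∩-event C-event (X∈-event n [])) λ { (_ , ()) }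
    P-∑ n (y ∷ ys) {C} C-event C⊑f =
      P-split-⊑ space C×∈-event (X-event n y) (λ ω → X n ω ≟ⱽ y)
        (P-mono-⊑ space (∩-event C×∈-event (X-event n y)) (∩-event C-event (X-event n y))
          (λ ((c , _) , X≡y) → c , X≡y)
          (C⊑f y))
        (P-mono-⊑ space (∩-event C×∈-event (∁-event (X-event n y))) (∩-event C-event (X∈-event n ys))
          (λ { ((c , here X≡y) , X≢y) → contradiction X≡y X≢y
             ; ((c , there X∈ys) , _) → c , X∈ys })
          (P-∑ n ys C-event C⊑f))
      where
      C×∈-event : Event (λ ω → C ω × X n ω ∈ y ∷ ys)
      C×∈-event = ∩-event C-event (X∈-event n (y ∷ ys))

    -- `Hit K j n`: from time n the chain reaches a within j steps, with all
    -- positions after time n in K; `Return` disregards a visit at time n itself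
    -- (and allows j + 1 steps).
    mutual
      Hit : List V → ℕ → ℕ → Pred Ω 0ℓ
      Hit K zero    n ω = X n ω ≡ a
      Hit K (suc j) n ω = X n ω ≡ a ⊎ Return K j n ω

      Return : List V → ℕ → ℕ → Pred Ω 0ℓ
      Return K j n ω = Hit K j (suc n) ω × X (suc n) ω ∈ K

    mutual
      Hit-event : ∀ K j n → Event (Hit K j n)
      Hit-event K zero    n = X-event n a
      Hit-event K (suc j) n = ∪-event (X-event n a) (Return-event K j n)

      Return-event : ∀ K j n → Event (Return K j n)
      Return-event K j n = ∩-event (Hit-event K j (suc n)) (X∈-event (suc n) K)

    mutual
      -- The bound on time makes these events decidable, as `P-continuity` asks of the approximating
      -- events.
      Hit? : ∀ K j n → Decidable (Hit K j n)
      Hit? K zero    n ω = X n ω ≟ⱽ a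
      Hit? K (suc j) n ω = X n ω ≟ⱽ a ⊎-dec Return? K j n ω

      Return? : ∀ K j n → Decidable (Return K j n)
      Return? K j n ω = Hit? K j (suc n) ω ×-dec X (suc n) ω ∈ˡ? K

    mutual
      Hit-mono : ∀ {K K′ j j′} → K ⊆ˡ K′ → j ℕ.≤ j′ → ∀ n → Hit K j n ⊆ Hit K′ j′ n
      Hit-mono {j = zero}  {zero}  K⊆ _         n X≡a        = X≡a
      Hit-mono {j = zero}  {suc _} K⊆ _         n X≡a        = inj₁ X≡a
      Hit-mono {j = suc _} {suc _} K⊆ (s≤s j≤j′) n (inj₁ X≡a) = inj₁ X≡a
      Hit-mono {j = suc _} {suc _} K⊆ (s≤s j≤j′) n (inj₂ ret) = inj₂ (Return-mono K⊆ j≤j′ n ret)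

      Return-mono : ∀ {K K′ j j′} → K ⊆ˡ K′ → j ℕ.≤ j′ → ∀ n → Return K j n ⊆ Return K′ j′ n
      Return-mono K⊆ j≤j′ n (hits , X∈K) = Hit-mono K⊆ j≤j′ (suc n) hits , K⊆ X∈K

    module _ (K : List V) where
      open Hitting K a

      mutual
        -- The whole history stays a parameter because the Markov property is stated for histories;
        -- the bound `k` on its probability accumulates the transition factors passed so far.
        P-Hit : ∀ j n y {k} → 0# ≼ k → P (History n y) ⊑ k →
                P (History n y ∩ Hit K j n) ⊑ k * hit j (y n)
        P-Hit j n y {k} 0≼k H⊑k with y n ≟ⱽ a
        P-Hit j n y {k} 0≼k H⊑k | yes _ = ⊑-respʳ-≈ (sym (*-identityʳ k))
          (P-mono-⊑ space (∩-event (History-event n y) (Hit-event K j n)) (History-event n y) proj₁ H⊑k)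
        P-Hit zero n y {k} 0≼k H⊑k | no yn≢a = ⊑-respʳ-≈ (sym (zeroʳ k))
          (P-∅-⊑ space (∩-event (History-event n y) (Hit-event K 0 n))
            λ (H , X≡a) → yn≢a (≡.trans (≡.sym (H n ℕ.≤-refl)) X≡a))
        P-Hit (suc j) n y {k} 0≼k H⊑k | no yn≢a = P-mono-⊑ space
          (∩-event (History-event n y) (Hit-event K (suc j) n))
          (∩-event (History-event n y) (Return-event K j n))
          (λ { (H , inj₁ X≡a) → contradiction (≡.trans (≡.sym (H n ℕ.≤-refl)) X≡a) yn≢a
             ; (H , inj₂ ret) → H , ret })
          (P-Return j n y 0≼k H⊑k)

        -- The event is split by the next state z, and the history is extended by z.
        P-Return : ∀ j n y {k} → 0# ≼ k → P (History n y) ⊑ k →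
                   P (History n y ∩ Return K j n) ⊑ k * average (hit j) (y n)
        P-Return j n y {k} 0≼k H⊑k = ⊑-respʳ-≈ (sym (*-∑ k S))
          (P-mono-⊑ space
            (∩-event (History-event n y) (Return-event K j n))
            (∩-event C-event (X∈-event (suc n) S))
            (λ (H , hits , X∈K) → (H , hits) , ∈-deduplicate⁺ _≟ⱽ_ X∈K)
            (P-∑ (suc n) S C-event via))
          where
          C : Pred Ω 0ℓ
          C = History n y ∩ Hit K j (suc n)
          C-event : Event C
          C-event = ∩-event (History-event n y) (Hit-event K j (suc n))
          via : ∀ z → P (λ ω → C ω × X (suc n) ω ≡ z) ⊑ k * (p (y n) z * hit j z)
          via z = ⊑-respʳ-≈
            (trans (*-assoc _ _ _) (*-congˡ (*-congˡ (reflexive (≡.cong (hit j) (extend-> n y z))))))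
            (P-mono-⊑ space
              (∩-event C-event (X-event (suc n) z))
              (∩-event (History-event (suc n) y′) (Hit-event K j (suc n)))
              (λ ((H , hits) , X≡z) → History-extend n y z H X≡z , hits)
              (P-Hit j (suc n) y′ (*-nonNeg 0≼k (p-nonNeg _ _)) (P-History-extend n y z 0≼k H⊑k)))
            where
            y′ = extend n y z

      -- The induction starts from the one-point history at `a`, with bound 1; outcomes that start
      -- elsewhere form a null event.
      P-return : ∀ j → P (Return K j 0) ⊑ average (hit j) a
      P-return j = ⊑-respʳ-≈ (trans (+-identityʳ _) (*-identityˡ _))
        (P-split-⊑ space R-event X₀-event (λ ω → X 0 ω ≟ⱽ a)
          (P-mono-⊑ space (∩-event R-event X₀-event) (∩-event H-event R-event)
            (λ (ret , X≡a) → (λ { zero z≤n → X≡a }) , ret)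
            (P-Return j 0 (λ _ → a) (inj₁ 0≺1)
              (P-mono-⊑ space H-event U-event (λ _ → tt) (⊑-respˡ-≤ʳ (proj₁ P-U) ⊑-1ʳ))))
          (⊑-respˡ-≤ʳ
            (P-null X₀-event (∩-event R-event (∁-event X₀-event)) start λ (X≡a , _ , X≢a) → X≢a X≡a)
            ⊑-0ʳ))
        where
        R-event  = Return-event K j 0
        X₀-event = X-event 0 a
        H-event  = History-event 0 (λ _ → a)

    -- Recurrence along an increasing family of finite sets.

    module _ (F : ℕ → List V) (F-mono : ∀ n → F n ⊆ˡ F (suc n)) (F-cover : ∀ x → ∃[ n ] x ∈ F n) where

      F-mono-≤ : ∀ {m n} → m ℕ.≤ n → F m ⊆ˡ F n
      F-mono-≤ = increasing {A = λ m → _∈ F m} F-mono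

      -- The next position lies in some `F l`. Passing to the maximum of m and l lets one index
      -- bound both the time and the region, so that the events form a single increasing sequence.
      returns : ∀ {ω} n → ∃[ m ] Hit (F m) m (suc n) ω → ∃[ m ] Return (F m) m n ω
      returns {ω} n (m , hits) =
        let l , X∈F = F-cover (X (suc n) ω)
        in m ℕ.⊔ l
         , Hit-mono (F-mono-≤ (ℕ.m≤m⊔n m l)) (ℕ.m≤m⊔n m l) (suc n) hits
         , F-mono-≤ (ℕ.m≤n⊔m m l) X∈F

      -- Working back from the visit at time j + n, each step adds one more position for some `F m`
      -- to cover.
      hits-eventually : ∀ {ω} j n → X (j ℕ.+ n) ω ≡ a → ∃[ m ] Hit (F m) m n ω
      hits-eventually zero    n X≡a = 0 , X≡a
      hits-eventually {ω} (suc j) n X≡a =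
        let m , ret = returns n (hits-eventually j (suc n)
              (≡.subst (λ i → X i ω ≡ a) (≡.sym (ℕ.+-suc j n)) X≡a))
        in suc m , inj₂ (Return-mono (F-mono m) ℕ.≤-refl n ret)

      recurrence⇒return : ∀ {q} → below (P (InfinitelyOften a)) q → ∃[ m ] below (P (Return (F m) m 0)) q
      recurrence⇒return = P-continuity (λ m → Return-event (F m) m 0) (λ m → Return? (F m) m 0)
        (λ m → Return-mono (F-mono m) (ℕ.n≤1+n m) 0) (InfinitelyOften-event a)
        -- A visit at some time n ≥ 1 is chosen, since the one at time 0 is no return; from time 1
        -- it is n - 1 steps away.
        (λ {ω} often → let n , 1≤n , X≡a = often 1 in
          returns 0 (hits-eventually (n ℕ.∸ 1) 1 (≡.subst (λ i → X i ω ≡ a) (≡.sym (ℕ.m∸n+n≡m 1≤n)) X≡a)))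

    -- Divergence of the Green function along the exhaustion.

    module _ (E : Exhaustion) (a∈K₀ : a ∈ Exhaustion.K E 0) where
      open Exhaustion E

      -- For δ = 1 / t, the chain returns to a inside some K n, n ≥ N, with probability
      -- greater than 1 - δ; hence cap(a) / b(a) ≼ δ there.
      G-finite-unbounded : P (InfinitelyOften a) ≈ʳ 1ʳ → ∀ {t} → 0ℚ ℚ.< t → ∀ N →
        ∃[ n ] N ℕ.≤ n ×
          (∀ {s} → below (ρ (cap (K-connected n) (K-from-0 a∈K₀ n) * deg a ⁻¹)) s → t ℚ.* s ℚ.≤ 1ℚ)
      G-finite-unbounded recurrent {t} 0<t N = n , ℕ.m≤m+n N m , bound
        where
        instance
          t-pos : ℚ.Positive t
          t-pos = ℚ.positive 0<t
          t-nonNeg : ℚ.NonNegative t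
          t-nonNeg = ℚ.pos⇒nonNeg t
          t-nonZero : ℚ.NonZero t
          t-nonZero = ℚ.pos⇒nonZero t
        δ = ℚ.1/ t
        0<δ : 0ℚ ℚ.< δ
        0<δ = ℚ.positive⁻¹ δ {{ℚ.1/pos⇒pos t}}
        1-δ<1 : 1ℚ ℚ.- δ ℚ.< 1ℚ
        1-δ<1 = x+y<x (ℚ.neg-antimono-< 0<δ)

        -- Dropping the first N sets makes the index found below at least N.
        F : ℕ → List V
        F m = K (N ℕ.+ m)
        F-mono : ∀ m → F m ⊆ˡ F (suc m)
        F-mono m rewrite ℕ.+-suc N m = K-mono (N ℕ.+ m)
        F-cover : ∀ x → ∃[ m ] x ∈ F m
        F-cover x = let m , x∈K = K-cover x in m , increasing {A = λ m → _∈ K m} K-mono (ℕ.m≤n+m m N) x∈K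

        return : ∃[ m ] below (P (Return (F m) m 0)) (1ℚ ℚ.- δ)
        return = recurrence⇒return F F-mono F-cover (proj₂ recurrent (1ℚ , ≡.refl , 1-δ<1))
        m n : ℕ
        m = proj₁ return
        n = N ℕ.+ m

        small : cap (K-connected n) (K-from-0 a∈K₀ n) * deg a ⁻¹ ≼ fromℚ δ
        small = Hitting.return+escape (K n) a (K-connected n) (K-from-0 a∈K₀ n)
          (proj₂ (potential-exists (K-connected n) (K-from-0 a∈K₀ n))) m
          (inj₁ (fromℚ-pos 0<δ))
          (trans (sym (fromℚ-+ (1ℚ ℚ.- δ) δ)) (trans (reflexive (≡.cong fromℚ (x-y+y≡x 1ℚ δ))) fromℚ-1))
          (below-≼ (P-return (K n) m) (proj₂ return))

        bound : ∀ {s} → _ → t ℚ.* s ℚ.≤ 1ℚ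
        bound {s} s∈ρ = ≡.subst (t ℚ.* s ℚ.≤_) (ℚ.*-inverseʳ t)
          (ℚ.*-monoˡ-≤-nonNeg t (fromℚ-cancel-≼ (≼-trans (below-≼ (⊑-ρ _) s∈ρ) small)))

      recurrent⇒G≈∞ : P (InfinitelyOften a) ≈ʳ 1ʳ → G E a∈K₀ ≈ʳ ∞
      recurrent⇒G≈∞ recurrent = (λ {q} _ → q ℚ.+ 1ℚ , tt , q<q+1 q) , λ {q} _ →
        -- This `t` is positive and strictly above `q`; applying the bound to `t + 1` places `t`
        -- strictly inside the cut of `1/ʳ`.
        let t = q ℚ.⊔ 0ℚ ℚ.+ 1ℚ
            0<t = ℚ.≤-<-trans (ℚ.p≤q⊔p q 0ℚ) (q<q+1 (q ℚ.⊔ 0ℚ))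
            0<t+1 = ℚ.<-trans 0<t (q<q+1 t)
        in t , (λ N → let n , N≤n , bound = G-finite-unbounded recurrent 0<t+1 N
                      in n , N≤n , t ℚ.+ 1ℚ , (ℚ.<⇒≤ 0<t+1 , bound) , q<q+1 t)
             , ℚ.≤-<-trans (ℚ.p≤p⊔q q 0ℚ) (q<q+1 (q ℚ.⊔ 0ℚ))
        where
        q<q+1 : ∀ q → q ℚ.< q ℚ.+ 1ℚ
        q<q+1 q = ≡.subst (ℚ._< q ℚ.+ 1ℚ) (ℚ.+-identityʳ q) (ℚ.+-monoʳ-< q (ℚ.positive⁻¹ 1ℚ))

corollary5p2 : (𝕂 : OrderedField) (V : Set) (countable : V ↣ ℕ)
    (graph : WeightedGraph 𝕂 V) →
    let open WeightedGraph graph in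
    Connected → (locallyFinite : LocallyFinite) →
    (E : Exhaustion) (a : V) (a∈K₀ : a ∈ Exhaustion.K E 0) →
    let open Network countable graph locallyFinite in
    (Recurrent π a → G E a∈K₀ ≈ʳ ∞) × (G E a∈K₀ <ʳ ∞ → Transient π a)
corollary5p2 𝕂 V countable graph _ locallyFinite E a a∈K₀ =
  -- The second claim is the contrapositive of the first: under recurrence, the rational separating
  -- `G` from `∞` would lie below `G`.
  recurrent⇒∞ , λ (_ , q∉G , q∈∞) recurrent → q∉G (proj₂ (recurrent⇒∞ recurrent) q∈∞)
  where
  open Network countable graph locallyFinite
  open NetworkLemmas countable graph locallyFinite
  recurrent⇒∞ : Recurrent π a → G E a∈K₀ ≈ʳ ∞
  recurrent⇒∞ (chain , recurrent) = ChainLemmas.recurrent⇒G≈∞ chain E a∈K₀ recurrent
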